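{- Let $n \ge 4$ and let $f : [1,\infty) \to \mathbb{R}$ be a convex function. Then for every unicyclic graph $G$ with $n$ vertices, $$ n f(2) \le I_f(G) \le f(n-1) + 2 f(2) + (n-3) f(1), $$ and both inequalities are attained (i.e., for each such $n$ and $f$, each of the two bounds is equal to $I_f(G)$ for some unicyclic graph $G$ with $n$ vertices).
   Context: All graphs are finite, connected, simple (no loops, no multiple edges) and have at least one edge. A unicyclic graph is a graph containing exactly one cycle. For a vertex $u$ of $G$, $d_u$ denotes its degree. For a function $f:[1,\infty)\to\mathbb{R}$, $I_f(G) = \sum_{u\in V(G)} f(d_u)$. -}

module Defs where

open import Level using (0ℓ)
open import Data.Nat.Base as ℕ using (ℕ; suc; z≤n; s≤s)
import Data.Nat.Properties as ℕₚ
open import Data.Integer.Base using (+_)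
import Data.Integer.Properties as ℤₚ
import Data.Integer.Base as ℤ
open import Data.Rational.Base as ℚ using (ℚ; 0ℚ; 1ℚ; ½)
import Data.Rational.Properties as ℚₚ
import Data.Rational.Unnormalised.Base as ℚᵘ
import Data.Rational.Unnormalised.Properties as ℚᵘₚ
open import Data.Rational.Solver using (module +-*-Solver)
open import Data.Fin.Base using (Fin; zero; suc)
open import Data.Fin.Subset using (Subset; ∣_∣)
open import Data.List.Base using (List; []; _∷_; [_]; _++_; length)
open import Data.List.Relation.Unary.Linked using (Linked)
open import Data.List.Relation.Unary.Unique.Propositional using (Unique)
open import Data.List.Relation.Binary.Infix.Heterogeneous using (Infix)
open import Data.Product.Base using (∃₂; Σ-syntax; ∃-syntax; _×_; _,_; proj₁; proj₂)
open import Data.Sum.Base using (_⊎_)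
open import Data.Vec.Base using (tabulate)
open import Data.Bool.Base using (Bool; true; false)
import Data.Vec.Functional as Vector
open import Function.Base using (_∘_)
open import Function.Bundles using (_⟶ₛ_; _⟨$⟩_; _⇔_)
open import Relation.Binary.Bundles using (Setoid)
open import Relation.Binary.Core using (Rel)
open import Relation.Binary.Definitions using (Decidable; Symmetric; Irreflexive)
open import Relation.Binary.Structures using (IsEquivalence)
import Relation.Binary.Construct.On as On
open import Relation.Binary.Construct.Closure.ReflexiveTransitive using (Star; ε; _◅_)
open import Relation.Binary.PropositionalEquality
  using (_≡_; refl; sym; trans; cong; subst)
open import Relation.Nullary.Decidable using (does; yes; no)
open import Relation.Nullary.Negation using (contradiction)

half-pos : ∀ {e} → 0ℚ ℚ.< e → 0ℚ ℚ.< ½ ℚ.* e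
half-pos {e} 0<e =
  ℚₚ.positive⁻¹ (½ ℚ.* e) {{ℚₚ.pos*pos⇒pos ½ e {{ℚ.positive 0<e}}}}

half+half : ∀ e → ½ ℚ.* e ℚ.+ ½ ℚ.* e ≡ e
half+half e = trans (sym (ℚₚ.*-distribʳ-+ e ½ ½)) (ℚₚ.*-identityˡ e)

half-sum : ∀ {e p q} → p ℚ.< ½ ℚ.* e → q ℚ.< ½ ℚ.* e → p ℚ.+ q ℚ.< e
half-sum {e} p< q< = subst (_ ℚ.<_) (half+half e) (ℚₚ.+-mono-< p< q<)

∣-∣-swap : ∀ p q → ℚ.∣ p ℚ.- q ∣ ≡ ℚ.∣ q ℚ.- p ∣
∣-∣-swap p q = trans (cong ℚ.∣_∣ (eq p q)) (ℚₚ.∣-p∣≡∣p∣ (q ℚ.- p))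
  where
  open +-*-Solver
  eq : ∀ p q → p ℚ.- q ≡ ℚ.- (q ℚ.- p)
  eq = solve 2 (λ p q → p :- q := :- (q :- p)) refl

∣-∣-triangle : ∀ p q r → ℚ.∣ p ℚ.- r ∣ ℚ.≤ ℚ.∣ p ℚ.- q ∣ ℚ.+ ℚ.∣ q ℚ.- r ∣
∣-∣-triangle p q r =
  subst (λ z → ℚ.∣ z ∣ ℚ.≤ ℚ.∣ p ℚ.- q ∣ ℚ.+ ℚ.∣ q ℚ.- r ∣) (eq p q r)
    (ℚₚ.∣p+q∣≤∣p∣+∣q∣ (p ℚ.- q) (q ℚ.- r))
  where
  open +-*-Solver
  eq : ∀ p q r → (p ℚ.- q) ℚ.+ (q ℚ.- r) ≡ p ℚ.- r
  eq = solve 3 (λ p q r → (p :- q) :+ (q :- r) := p :- r) refl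

-- ℝ is the setoid of Cauchy sequences of rationals up to _≈_; the convergence
-- modulus is part of the data of cauchy.

IsCauchy : (ℕ → ℚ) → Set
IsCauchy x = ∀ e → 0ℚ ℚ.< e →
  ∃[ N ] (∀ m n → N ℕ.≤ m → N ℕ.≤ n → ℚ.∣ x m ℚ.- x n ∣ ℚ.< e)

record ℝ : Set where
  constructor mkℝ
  field
    seq    : ℕ → ℚ
    cauchy : IsCauchy seq

open ℝ public

infix 4 _≈_ _≤_

_≈_ : Rel ℝ 0ℓ
x ≈ y = ∀ e → 0ℚ ℚ.< e →
  ∃[ N ] (∀ n → N ℕ.≤ n → ℚ.∣ seq x n ℚ.- seq y n ∣ ℚ.< e)

_≤_ : Rel ℝ 0ℓ
x ≤ y = ∀ e → 0ℚ ℚ.< e →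
  ∃[ N ] (∀ n → N ℕ.≤ n → seq x n ℚ.≤ seq y n ℚ.+ e)

≈-isEquivalence : IsEquivalence _≈_
≈-isEquivalence = record
  { refl  = λ {x} e 0<e → 0 , λ n _ →
      subst (ℚ._< e) (sym (cong ℚ.∣_∣ (ℚₚ.+-inverseʳ (seq x n)))) 0<e
  ; sym   = λ {x} {y} x≈y e 0<e → proj₁ (x≈y e 0<e) , λ n N≤n →
      subst (ℚ._< e) (∣-∣-swap (seq x n) (seq y n)) (proj₂ (x≈y e 0<e) n N≤n)
  ; trans = λ {x} {y} {z} x≈y y≈z e 0<e →
      let N₁ , p = x≈y (½ ℚ.* e) (half-pos 0<e)
          N₂ , q = y≈z (½ ℚ.* e) (half-pos 0<e)
      in N₁ ℕ.⊔ N₂ , λ n N≤n → ℚₚ.≤-<-trans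
           (∣-∣-triangle (seq x n) (seq y n) (seq z n))
           (half-sum (p n (ℕₚ.m⊔n≤o⇒m≤o N₁ N₂ N≤n)) (q n (ℕₚ.m⊔n≤o⇒n≤o N₁ N₂ N≤n)))
  }

ℝ-setoid : Setoid 0ℓ 0ℓ
ℝ-setoid = record { isEquivalence = ≈-isEquivalence }

fromℚ : ℚ → ℝ
fromℚ q = mkℝ (λ _ → q) λ e 0<e → 0 , λ _ _ _ _ →
  subst (ℚ._< e) (sym (cong ℚ.∣_∣ (ℚₚ.+-inverseʳ q))) 0<e

fromℕ : ℕ → ℝ
fromℕ n = fromℚ (+ n ℚ./ 1)

infixl 6 _+_ _-_
infixl 7 _*_

_+_ : ℝ → ℝ → ℝ
x + y = mkℝ (λ n → seq x n ℚ.+ seq y n) λ e 0<e →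
  let N₁ , p = cauchy x (½ ℚ.* e) (half-pos 0<e)
      N₂ , q = cauchy y (½ ℚ.* e) (half-pos 0<e)
  in N₁ ℕ.⊔ N₂ , λ m n N≤m N≤n → ℚₚ.≤-<-trans
       (bound (seq x m) (seq x n) (seq y m) (seq y n))
       (half-sum (p m n (ℕₚ.m⊔n≤o⇒m≤o N₁ N₂ N≤m) (ℕₚ.m⊔n≤o⇒m≤o N₁ N₂ N≤n))
                 (q m n (ℕₚ.m⊔n≤o⇒n≤o N₁ N₂ N≤m) (ℕₚ.m⊔n≤o⇒n≤o N₁ N₂ N≤n)))
  where
  open +-*-Solver
  eq : ∀ a b c d → (a ℚ.- b) ℚ.+ (c ℚ.- d) ≡ (a ℚ.+ c) ℚ.- (b ℚ.+ d)
  eq = solve 4 (λ a b c d → (a :- b) :+ (c :- d) := (a :+ c) :- (b :+ d)) refl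
  bound : ∀ a b c d →
    ℚ.∣ (a ℚ.+ c) ℚ.- (b ℚ.+ d) ∣ ℚ.≤ ℚ.∣ a ℚ.- b ∣ ℚ.+ ℚ.∣ c ℚ.- d ∣
  bound a b c d = subst (λ z → ℚ.∣ z ∣ ℚ.≤ ℚ.∣ a ℚ.- b ∣ ℚ.+ ℚ.∣ c ℚ.- d ∣)
    (eq a b c d) (ℚₚ.∣p+q∣≤∣p∣+∣q∣ (a ℚ.- b) (c ℚ.- d))

-_ : ℝ → ℝ
- x = mkℝ (λ n → ℚ.- seq x n) λ e 0<e →
  let N , p = cauchy x e 0<e
  in N , λ m n N≤m N≤n →
       subst (ℚ._< e) (cong ℚ.∣_∣ (eq (seq x n) (seq x m))) (p n m N≤n N≤m)
  where
  open +-*-Solver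
  eq : ∀ a b → a ℚ.- b ≡ ℚ.- b ℚ.- (ℚ.- a)
  eq = solve 2 (λ a b → a :- b := :- b :- (:- a)) refl

_-_ : ℝ → ℝ → ℝ
x - y = x + (- y)

eventually-bounded : ∀ x → IsCauchy x →
  ∃₂ λ N A → ℚ.Positive A × (∀ n → N ℕ.≤ n → ℚ.∣ x n ∣ ℚ.≤ A)
eventually-bounded x cx =
  let N , p = cx 1ℚ (ℚₚ.positive⁻¹ 1ℚ)
  in N , ℚ.∣ x N ∣ ℚ.+ 1ℚ
   , ℚₚ.nonNeg+pos⇒pos ℚ.∣ x N ∣ {{ℚₚ.∣-∣-nonNeg (x N)}} 1ℚ
   , λ n N≤n → ℚₚ.≤-trans
       (subst (λ z → ℚ.∣ z ∣ ℚ.≤ ℚ.∣ x N ∣ ℚ.+ ℚ.∣ x n ℚ.- x N ∣) (eq (x N) (x n))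
         (ℚₚ.∣p+q∣≤∣p∣+∣q∣ (x N) (x n ℚ.- x N)))
       (ℚₚ.+-monoʳ-≤ ℚ.∣ x N ∣ (ℚₚ.<⇒≤ (p n N N≤n ℕₚ.≤-refl)))
  where
  open +-*-Solver
  eq : ∀ a b → a ℚ.+ (b ℚ.- a) ≡ b
  eq = solve 2 (λ a b → a :+ (b :- a) := b) refl

scaled-< : ∀ {A a d e} {{A>0 : ℚ.Positive A}} → ℚ.∣ a ∣ ℚ.≤ A →
  ℚ.∣ d ∣ ℚ.< (ℚ.1/ A) {{ℚₚ.pos⇒nonZero A}} ℚ.* e → ℚ.∣ a ℚ.* d ∣ ℚ.< e
scaled-< {A} {a} {d} {e} {{A>0}} a≤A d< = begin-strict
  ℚ.∣ a ℚ.* d ∣              ≡⟨ ℚₚ.∣p*q∣≡∣p∣*∣q∣ a d ⟩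
  ℚ.∣ a ∣ ℚ.* ℚ.∣ d ∣        ≤⟨ ℚₚ.*-monoʳ-≤-nonNeg ℚ.∣ d ∣ {{ℚₚ.∣-∣-nonNeg d}} a≤A ⟩
  A ℚ.* ℚ.∣ d ∣              <⟨ ℚₚ.*-monoʳ-<-pos A d< ⟩
  A ℚ.* (1/A ℚ.* e)          ≡⟨ sym (ℚₚ.*-assoc A 1/A e) ⟩
  (A ℚ.* 1/A) ℚ.* e          ≡⟨ cong (ℚ._* e) (ℚₚ.*-inverseʳ A {{ℚₚ.pos⇒nonZero A}}) ⟩
  1ℚ ℚ.* e                   ≡⟨ ℚₚ.*-identityˡ e ⟩
  e                          ∎
  where
  open ℚₚ.≤-Reasoning
  1/A : ℚ
  1/A = (ℚ.1/ A) {{ℚₚ.pos⇒nonZero A}}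

1/-scaled-pos : ∀ A {{A>0 : ℚ.Positive A}} {e} → 0ℚ ℚ.< e →
  0ℚ ℚ.< (ℚ.1/ A) {{ℚₚ.pos⇒nonZero A}} ℚ.* e
1/-scaled-pos A {e} 0<e = ℚₚ.positive⁻¹ _
  {{ℚₚ.pos*pos⇒pos ((ℚ.1/ A) {{ℚₚ.pos⇒nonZero A}}) {{ℚₚ.1/pos⇒pos A}} e {{ℚ.positive 0<e}}}}

*-cauchy : ∀ x y → IsCauchy x → IsCauchy y → IsCauchy (λ n → x n ℚ.* y n)
*-cauchy x y cx cy e 0<e =
  let Nx , A , A>0 , bx = eventually-bounded x cx
      Ny , B , B>0 , by = eventually-bounded y cy
      N₁ , p = cx _ (1/-scaled-pos B {{B>0}} (half-pos 0<e))
      N₂ , q = cy _ (1/-scaled-pos A {{A>0}} (half-pos 0<e))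
      M₁ = Nx ℕ.⊔ Ny
      M₂ = N₁ ℕ.⊔ N₂
  in M₁ ℕ.⊔ M₂ , λ m n N≤m N≤n →
    let m₁ = ℕₚ.m⊔n≤o⇒m≤o M₁ M₂ N≤m
        m₂ = ℕₚ.m⊔n≤o⇒n≤o M₁ M₂ N≤m
        n₁ = ℕₚ.m⊔n≤o⇒m≤o M₁ M₂ N≤n
        n₂ = ℕₚ.m⊔n≤o⇒n≤o M₁ M₂ N≤n
    in ℚₚ.≤-<-trans
      (subst (λ z → ℚ.∣ z ∣ ℚ.≤ ℚ.∣ x m ℚ.* (y m ℚ.- y n) ∣ ℚ.+ ℚ.∣ y n ℚ.* (x m ℚ.- x n) ∣)
        (eq (x m) (x n) (y m) (y n))
        (ℚₚ.∣p+q∣≤∣p∣+∣q∣ (x m ℚ.* (y m ℚ.- y n)) (y n ℚ.* (x m ℚ.- x n))))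
      (half-sum
        (scaled-< {A} {x m} {{A>0}} (bx m (ℕₚ.m⊔n≤o⇒m≤o Nx Ny m₁))
          (q m n (ℕₚ.m⊔n≤o⇒n≤o N₁ N₂ m₂) (ℕₚ.m⊔n≤o⇒n≤o N₁ N₂ n₂)))
        (scaled-< {B} {y n} {{B>0}} (by n (ℕₚ.m⊔n≤o⇒n≤o Nx Ny n₁))
          (p m n (ℕₚ.m⊔n≤o⇒m≤o N₁ N₂ m₂) (ℕₚ.m⊔n≤o⇒m≤o N₁ N₂ n₂))))
  where
  open +-*-Solver
  eq : ∀ a b c d → a ℚ.* (c ℚ.- d) ℚ.+ d ℚ.* (a ℚ.- b) ≡ a ℚ.* c ℚ.- b ℚ.* d
  eq = solve 4 (λ a b c d → a :* (c :- d) :+ d :* (a :- b) := a :* c :- b :* d) refl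

_*_ : ℝ → ℝ → ℝ
x * y = mkℝ (λ n → seq x n ℚ.* seq y n) (*-cauchy (seq x) (seq y) (cauchy x) (cauchy y))

sum : ∀ {n} → (Fin n → ℝ) → ℝ
sum = Vector.foldr _+_ (fromℕ 0)

[1,∞[ : Setoid 0ℓ 0ℓ
[1,∞[ = record
  { Carrier       = Σ[ x ∈ ℝ ] fromℕ 1 ≤ x
  ; _≈_           = λ x y → proj₁ x ≈ proj₁ y
  ; isEquivalence = On.isEquivalence proj₁ ≈-isEquivalence
  }

-- An element of [1,∞[ carries its membership proof, so t x + (1 - t) y enters as
-- any element z of [1,∞[ equal to it (f respects _≈_).
Convex : ([1,∞[ ⟶ₛ ℝ-setoid) → Set
Convex f = ∀ (x y z : Setoid.Carrier [1,∞[) (t : ℝ) → fromℕ 0 ≤ t → t ≤ fromℕ 1 →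
  proj₁ z ≈ t * proj₁ x + (fromℕ 1 - t) * proj₁ y →
  f ⟨$⟩ z ≤ t * (f ⟨$⟩ x) + (fromℕ 1 - t) * (f ⟨$⟩ y)

fromℚ-mono-≤ : ∀ {p q} → p ℚ.≤ q → fromℚ p ≤ fromℚ q
fromℚ-mono-≤ {p} {q} p≤q e 0<e = 0 , λ _ _ →
  subst (ℚ._≤ q ℚ.+ e) (ℚₚ.+-identityʳ p) (ℚₚ.+-mono-≤ p≤q (ℚₚ.<⇒≤ 0<e))

fromℕ-mono-≤ : ∀ {m n} → m ℕ.≤ n → fromℕ m ≤ fromℕ n
fromℕ-mono-≤ {m} {n} m≤n = fromℚ-mono-≤ {+ m ℚ./ 1} {+ n ℚ./ 1} (ℚₚ.toℚᵘ-cancel-≤ (begin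
  ℚ.toℚᵘ (+ m ℚ./ 1)    ≃⟨ ℚₚ.toℚᵘ-fromℚᵘ (ℚᵘ.mkℚᵘ (+ m) 0) ⟩
  ℚᵘ.mkℚᵘ (+ m) 0       ≤⟨ ℚᵘ.*≤* (ℤₚ.*-monoʳ-≤-nonNeg (+ 1) (ℤ.+≤+ m≤n)) ⟩
  ℚᵘ.mkℚᵘ (+ n) 0       ≃⟨ ℚᵘₚ.≃-sym (ℚₚ.toℚᵘ-fromℚᵘ (ℚᵘ.mkℚᵘ (+ n) 0)) ⟩
  ℚ.toℚᵘ (+ n ℚ./ 1)    ∎))
  where open ℚᵘₚ.≤-Reasoning

infix 8 _at_[_]

_at_[_] : ([1,∞[ ⟶ₛ ℝ-setoid) → (k : ℕ) → 1 ℕ.≤ k → ℝ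
f at k [ 1≤k ] = f ⟨$⟩ (fromℕ k , fromℕ-mono-≤ 1≤k)

4≤n⇒1≤n∸1 : ∀ {n} → 4 ℕ.≤ n → 1 ℕ.≤ n ℕ.∸ 1
4≤n⇒1≤n∸1 (s≤s (s≤s _)) = s≤s z≤n

record Graph (n : ℕ) : Set₁ where
  infix 4 _~_ _~?_
  field
    _~_       : Rel (Fin n) 0ℓ
    _~?_      : Decidable _~_
    ~-sym     : Symmetric _~_
    ~-irrefl  : Irreflexive _≡_ _~_
    connected : ∀ u v → Star _~_ u v
    hasEdge   : ∃₂ λ u v → u ~ v

  neighbours : Fin n → Subset n
  neighbours u = tabulate (λ v → does (u ~? v))

  degree : Fin n → ℕ
  degree u = ∣ neighbours u ∣

  hasNeighbour : ∀ u → ∃[ v ] u ~ v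
  hasNeighbour u with hasEdge
  ... | a , b , a~b with connected u a
  ...   | ε         = b , a~b
  ...   | u~v ◅ _   = _ , u~v

  count-pos : ∀ {k} (g : Fin k → Bool) v → g v ≡ true → 1 ℕ.≤ ∣ tabulate g ∣
  count-pos {suc k} g v eq with g zero in g0
  ... | true = s≤s z≤n
  count-pos {suc k} g zero    eq | false = contradiction (trans (sym g0) eq) λ ()
  count-pos {suc k} g (suc v) eq | false = count-pos (g ∘ suc) v eq

  1≤degree : ∀ u → 1 ℕ.≤ degree u
  1≤degree u with hasNeighbour u
  ... | v , u~v = count-pos (λ w → does (u ~? w)) v does-true
    where
    does-true : does (u ~? v) ≡ true
    does-true with u ~? v
    ... | yes _   = refl
    ... | no u≁v  = contradiction u~v u≁v

  -- The cycle v₀ v₁ … vₖ v₀, with start = v₀ and rest = v₁ … vₖ.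
  record Cycle : Set where
    field
      start    : Fin n
      rest     : List (Fin n)
      length≥3 : 3 ℕ.≤ length (start ∷ rest)
      distinct : Unique (start ∷ rest)
      adjacent : Linked _~_ (start ∷ rest ++ [ start ])

    HasEdge : Rel (Fin n) 0ℓ
    HasEdge u v = Consecutive u v ⊎ Consecutive v u
      where
      Consecutive : Rel (Fin n) 0ℓ
      Consecutive a b = Infix _≡_ (a ∷ b ∷ []) (start ∷ rest ++ [ start ])

  -- Cycles are subgraphs: choices of start vertex and orientation are
  -- identified by comparing edge sets.
  SameCycle : Rel Cycle 0ℓ
  SameCycle C D = ∀ u v → Cycle.HasEdge C u v ⇔ Cycle.HasEdge D u v

  Unicyclic : Set
  Unicyclic = Σ[ C ∈ Cycle ] (∀ D → SameCycle D C)

open Graph public using (degree; 1≤degree; Unicyclic)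

I : ([1,∞[ ⟶ₛ ℝ-setoid) → ∀ {n} → Graph n → ℝ
I f G = sum (λ u → f at degree G u [ 1≤degree G u ])

{-# OPTIONS --safe #-}

-- Let rr′ be an edge of the cycle. Removing it leaves G connected, so
-- breadth-first search towards r gives each u ≠ r a parent π u; put π r = r′.
-- Any edge not of the form {u, π u} would close a second cycle, one avoiding
-- rr′. Hence the edges are the n distinct pairs {u, π u} and the degrees sum
-- to 2n. On the integers, f lies above the line through (1, f 1) and (2, f 2),
-- and on [2, n-1] below the chord between 2 and n-1. Summing the first bound
-- over the degrees gives n f 2; summing the second, with a nonnegative
-- correction for each of the at most n-3 leaves, gives the upper bound.
-- Equality holds for the n-cycle and for a triangle with n-3 leaves attached
-- to one corner.

module Submission where

open import Defs
open import Data.Bool.Base using (Bool; true; false; if_then_else_; T)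
open import Data.Bool.Properties using (T?)
open import Data.Empty using (⊥)
open import Data.Fin.Base using (Fin; zero; suc; toℕ; inject₁) renaming (fromℕ to lastFin)
open import Data.Fin.Induction using (<-weakInduction)
open import Data.Fin.Properties
  using (_≟_; any?; all?; toℕ<n; toℕ-injective; toℕ-inject₁; toℕ-fromℕ)
open import Data.Fin.Subset as Subset using (Subset; ∣_∣)
import Data.Fin.Subset.Properties as Subsetₚ
open import Data.Integer.Base as ℤ using (+_)
import Data.Integer.Properties as ℤₚ
open import Data.List.Base as List using (List; []; _∷_; [_]; _++_; length)
import Data.List.Membership.DecPropositional as DecMembership
open import Data.List.Membership.Propositional using (_∈_)
import Data.List.Membership.Propositional.Properties as ∈ₚ
open import Data.List.Relation.Binary.Infix.Heterogeneous using (Infix; here; there)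
open import Data.List.Relation.Binary.Prefix.Heterogeneous using ([]; _∷_)
open import Data.List.Relation.Unary.All as All using (All; []; _∷_)
import Data.List.Relation.Unary.All.Properties as Allₚ
open import Data.List.Relation.Unary.AllPairs as AllPairs using ([]; _∷_)
open import Data.List.Relation.Unary.Any using (here; there)
open import Data.List.Relation.Unary.Linked as Linked using (Linked; [-]; _∷_)
open import Data.List.Relation.Unary.Unique.Propositional using (Unique)
import Data.List.Relation.Unary.Unique.Propositional.Properties as Uniqueₚ
open import Data.Nat.Base using (ℕ; zero; suc; _∸_; z≤n; s≤s) renaming (_≤_ to _≤ℕ_; _<_ to _<ℕ_)
import Data.Nat.Base as ℕ
open import Data.Nat.Induction using (<-wellFounded)
import Data.Nat.Properties as ℕₚ
open import Data.Product.Base as Product using (Σ-syntax; ∃-syntax; ∃₂; _×_; _,_; proj₁; proj₂)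
open import Data.Rational.Base as ℚ using (ℚ; 0ℚ; 1ℚ; ½)
import Data.Rational.Properties as ℚₚ
open import Data.Rational.Solver using (module +-*-Solver)
import Data.Rational.Unnormalised.Base as ℚᵘ
import Data.Rational.Unnormalised.Properties as ℚᵘₚ
open import Data.Sum.Base using (_⊎_; inj₁; inj₂; swap; [_,_]′)
open import Data.Unit.Base using (tt)
open import Data.Vec.Base using (tabulate)
import Data.Vec.Functional as Vector
import Data.Vec.Properties as Vecₚ
open import Function.Base using (_∘_; id)
open import Function.Bundles using (_⟶ₛ_; module Func; mk⇔; module Equivalence)
open import Induction.WellFounded using (Acc; acc)
open import Level using (0ℓ)
open import Relation.Binary.Construct.Closure.ReflexiveTransitive as Star using (Star; ε; _◅_; _◅◅_)
open import Relation.Binary.Core using (Rel; _⇒_)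
open import Relation.Binary.Definitions using (Decidable; Symmetric)
open import Relation.Binary.PropositionalEquality hiding ([_])
open import Relation.Binary.Structures using (IsEquivalence)
open import Relation.Nullary.Decidable
  using (Dec; yes; no; does; dec-true; from-yes; _×-dec_; _⊎-dec_; _→-dec_; ¬?)
open import Relation.Nullary.Negation using (¬_; contradiction)
import Relation.Unary as Unary

open import Algebra.Properties.CommutativeMonoid.Sum ℕₚ.+-0-commutativeMonoid
  using (∑-distrib-+; ∑-comm; sum-replicate-zero)
  renaming (sum to ∑ℕ; sum-cong-≗ to ∑ℕ-cong)
open +-*-Solver using (solve; _:=_; con; _:+_; _:*_; _:-_)

-- Natural numbers inside the rationals.

ι : ℕ → ℚ
ι n = + n ℚ./ 1

ι-+ : ∀ m n → ι (m ℕ.+ n) ≡ ι m ℚ.+ ι n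
ι-+ m n = ℚₚ.toℚᵘ-injective (begin
  ℚ.toℚᵘ (ι (m ℕ.+ n))                    ≈⟨ lift (m ℕ.+ n) ⟩
  ℚᵘ.mkℚᵘ (+ (m ℕ.+ n)) 0                 ≈⟨ ℚᵘ.*≡* (cong (λ k → + k ℤ.* + 1) (sym (cong₂ ℕ._+_ (ℕₚ.*-identityʳ m) (ℕₚ.*-identityʳ n)))) ⟩
  ℚᵘ.mkℚᵘ (+ (m ℕ.* 1 ℕ.+ n ℕ.* 1)) 0     ≈⟨ ℚᵘ.*≡* (cong (ℤ._* + 1) (trans (ℤₚ.pos-+ (m ℕ.* 1) (n ℕ.* 1)) (cong₂ ℤ._+_ (ℤₚ.pos-* m 1) (ℤₚ.pos-* n 1)))) ⟩
  ℚᵘ.mkℚᵘ (+ m) 0 ℚᵘ.+ ℚᵘ.mkℚᵘ (+ n) 0    ≈⟨ ℚᵘₚ.+-cong (lift m) (lift n) ⟨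
  ℚ.toℚᵘ (ι m) ℚᵘ.+ ℚ.toℚᵘ (ι n)          ≈⟨ ℚₚ.toℚᵘ-homo-+ (ι m) (ι n) ⟨
  ℚ.toℚᵘ (ι m ℚ.+ ι n)                    ∎)
  where
  open ℚᵘₚ.≃-Reasoning
  lift : ∀ k → ℚ.toℚᵘ (ι k) ℚᵘ.≃ ℚᵘ.mkℚᵘ (+ k) 0
  lift k = ℚₚ.toℚᵘ-fromℚᵘ (ℚᵘ.mkℚᵘ (+ k) 0)

ι-suc : ∀ n → ι (suc n) ≡ 1ℚ ℚ.+ ι n
ι-suc = ι-+ 1

ι-nonNegative : ∀ n → 0ℚ ℚ.≤ ι n
ι-nonNegative zero    = ℚₚ.≤-refl
ι-nonNegative (suc n) = subst (0ℚ ℚ.≤_) (sym (ι-suc n))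
  (ℚₚ.+-mono-≤ {0ℚ} {1ℚ} (ℚₚ.<⇒≤ (ℚₚ.positive⁻¹ 1ℚ)) (ι-nonNegative n))

ι-positive : ∀ n → ℚ.Positive (ι (suc n))
ι-positive n = subst ℚ.Positive (sym (ι-suc n))
  (ℚₚ.pos+nonNeg⇒pos 1ℚ (ι n) {{ℚ.nonNegative (ι-nonNegative n)}})

-- This is 1/(n+1): shifting the argument avoids a nonzero hypothesis at every use.
1/ι : ℕ → ℚ
1/ι n = (ℚ.1/ ι (suc n)) {{ℚₚ.pos⇒nonZero (ι (suc n)) {{ι-positive n}}}}

1/ι-positive : ∀ n → ℚ.Positive (1/ι n)
1/ι-positive n = ℚₚ.1/pos⇒pos (ι (suc n)) {{ι-positive n}}

ι*1/ι : ∀ n → ι (suc n) ℚ.* 1/ι n ≡ 1ℚ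
ι*1/ι n = ℚₚ.*-inverseʳ (ι (suc n)) {{ℚₚ.pos⇒nonZero (ι (suc n)) {{ι-positive n}}}}

-- Cauchy reals

-- Arithmetic on reals is termwise, so algebraic identities reduce through this to identities of
-- rationals.
≗⇒≈ : ∀ {x y} → seq x ≗ seq y → x ≈ y
≗⇒≈ {x} {y} eq e 0<e = 0 , λ n _ → subst (ℚ._< e) (sym (cong ℚ.∣_∣
  (trans (cong (ℚ._- seq y n) (eq n)) (ℚₚ.+-inverseʳ (seq y n))))) 0<e

≈-refl : ∀ {x} → x ≈ x
≈-refl {x} = ≗⇒≈ {x} {x} λ _ → refl

≈-trans : ∀ {x y z} → x ≈ y → y ≈ z → x ≈ z
≈-trans {x} {y} {z} = IsEquivalence.trans ≈-isEquivalence {x} {y} {z}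

≤-reflexive : ∀ {x y} → x ≈ y → x ≤ y
≤-reflexive {x} {y} x≈y e 0<e = let N , p = x≈y e 0<e in N , λ n N≤n →
  subst₂ ℚ._≤_ (y+[x-y]≡x (seq x n) (seq y n)) refl
    (ℚₚ.+-monoʳ-≤ (seq y n) (ℚₚ.≤-trans (p≤∣p∣ (seq x n ℚ.- seq y n)) (ℚₚ.<⇒≤ (p n N≤n))))
  where
  y+[x-y]≡x : ∀ a b → b ℚ.+ (a ℚ.- b) ≡ a
  y+[x-y]≡x = solve 2 (λ a b → b :+ (a :- b) := a) refl
  p≤∣p∣ : ∀ p → p ℚ.≤ ℚ.∣ p ∣
  p≤∣p∣ p with ℚₚ.≤-total 0ℚ p
  ... | inj₁ 0≤p = ℚₚ.≤-reflexive (sym (ℚₚ.0≤p⇒∣p∣≡p 0≤p))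
  ... | inj₂ p≤0 = ℚₚ.≤-trans p≤0 (ℚₚ.0≤∣p∣ p)

≤-trans : ∀ {x y z} → x ≤ y → y ≤ z → x ≤ z
≤-trans {x} {y} {z} x≤y y≤z e 0<e =
  let N₁ , p = x≤y (½ ℚ.* e) (half-pos 0<e)
      N₂ , q = y≤z (½ ℚ.* e) (half-pos 0<e)
  in N₁ ℕ.⊔ N₂ , λ n N≤n → subst (seq x n ℚ.≤_)
       (trans (ℚₚ.+-assoc (seq z n) _ _) (cong (seq z n ℚ.+_) (half+half e)))
       (ℚₚ.≤-trans (p n (ℕₚ.m⊔n≤o⇒m≤o N₁ N₂ N≤n))
         (ℚₚ.+-monoˡ-≤ (½ ℚ.* e) (q n (ℕₚ.m⊔n≤o⇒n≤o N₁ N₂ N≤n))))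

+-mono-≤ : ∀ {x y u v} → x ≤ y → u ≤ v → x + u ≤ y + v
+-mono-≤ {x} {y} {u} {v} x≤y u≤v e 0<e =
  let N₁ , p = x≤y (½ ℚ.* e) (half-pos 0<e)
      N₂ , q = u≤v (½ ℚ.* e) (half-pos 0<e)
  in N₁ ℕ.⊔ N₂ , λ n N≤n → subst (seq x n ℚ.+ seq u n ℚ.≤_)
       (trans (interchange (seq y n) (½ ℚ.* e) (seq v n) (½ ℚ.* e))
              (cong (seq y n ℚ.+ seq v n ℚ.+_) (half+half e)))
       (ℚₚ.+-mono-≤ (p n (ℕₚ.m⊔n≤o⇒m≤o N₁ N₂ N≤n)) (q n (ℕₚ.m⊔n≤o⇒n≤o N₁ N₂ N≤n)))
  where
  interchange : ∀ a b c d → (a ℚ.+ b) ℚ.+ (c ℚ.+ d) ≡ (a ℚ.+ c) ℚ.+ (b ℚ.+ d)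
  interchange = solve 4 (λ a b c d → (a :+ b) :+ (c :+ d) := (a :+ c) :+ (b :+ d)) refl

+-cong : ∀ {x y u v} → x ≈ y → u ≈ v → x + u ≈ y + v
+-cong {x} {y} {u} {v} x≈y u≈v e 0<e =
  let N₁ , p = x≈y (½ ℚ.* e) (half-pos 0<e)
      N₂ , q = u≈v (½ ℚ.* e) (half-pos 0<e)
  in N₁ ℕ.⊔ N₂ , λ n N≤n → ℚₚ.≤-<-trans
       (subst (λ z → ℚ.∣ z ∣ ℚ.≤ ℚ.∣ seq x n ℚ.- seq y n ∣ ℚ.+ ℚ.∣ seq u n ℚ.- seq v n ∣)
         (eq (seq x n) (seq y n) (seq u n) (seq v n))
         (ℚₚ.∣p+q∣≤∣p∣+∣q∣ (seq x n ℚ.- seq y n) (seq u n ℚ.- seq v n)))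
       (half-sum (p n (ℕₚ.m⊔n≤o⇒m≤o N₁ N₂ N≤n)) (q n (ℕₚ.m⊔n≤o⇒n≤o N₁ N₂ N≤n)))
  where
  eq : ∀ a b c d → (a ℚ.- b) ℚ.+ (c ℚ.- d) ≡ (a ℚ.+ c) ℚ.- (b ℚ.+ d)
  eq = solve 4 (λ a b c d → (a :- b) :+ (c :- d) := (a :+ c) :- (b :+ d)) refl

-- Every linear rearrangement of an inequality is an instance; the ring solver
-- for ℚ proves the hypothesis.
≤-rescale : ∀ {x y u v} c {{_ : ℚ.Positive c}} →
  (∀ k → c ℚ.* (seq y k ℚ.- seq x k) ≡ seq v k ℚ.- seq u k) → x ≤ y → u ≤ v
≤-rescale {x} {y} {u} {v} c {{c>0}} eq x≤y e 0<e =
  -- Multiplying by `c` also scales the error, so the premise is taken with error `e` divided by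
  -- `c`.
  let N , p = x≤y _ (1/-scaled-pos c {{c>0}} 0<e)
  in N , λ n N≤n → subst₂ ℚ._≤_
       (solve 2 (λ a b → (b :- a) :+ a := b) refl (c ℚ.* seq x n) (seq u n))
       (begin
         (seq u n ℚ.- c ℚ.* seq x n) ℚ.+ c ℚ.* (seq y n ℚ.+ c⁻¹ ℚ.* e)
           ≡⟨ solve 6 (λ u c x y c⁻¹ e →
                (u :- c :* x) :+ c :* (y :+ c⁻¹ :* e) := u :+ (c :* (y :- x) :+ (c :* c⁻¹) :* e))
                refl (seq u n) c (seq x n) (seq y n) c⁻¹ e ⟩
         seq u n ℚ.+ (c ℚ.* (seq y n ℚ.- seq x n) ℚ.+ (c ℚ.* c⁻¹) ℚ.* e)
           ≡⟨ cong₂ (λ p q → seq u n ℚ.+ (p ℚ.+ q ℚ.* e)) (eq n) (ℚₚ.*-inverseʳ c {{ℚₚ.pos⇒nonZero c {{c>0}}}}) ⟩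
         seq u n ℚ.+ ((seq v n ℚ.- seq u n) ℚ.+ 1ℚ ℚ.* e)
           ≡⟨ solve 3 (λ u v e → u :+ ((v :- u) :+ con 1ℚ :* e) := v :+ e) refl (seq u n) (seq v n) e ⟩
         seq v n ℚ.+ e ∎)
       (ℚₚ.+-monoʳ-≤ (seq u n ℚ.- c ℚ.* seq x n)
         (ℚₚ.*-monoˡ-≤-nonNeg c {{ℚₚ.pos⇒nonNeg c {{c>0}}}} (p n N≤n)))
  where
  open ≡-Reasoning
  c⁻¹ : ℚ
  c⁻¹ = (ℚ.1/ c) {{ℚₚ.pos⇒nonZero c {{c>0}}}}

sum-mono-≤ : ∀ {n} {g h : Fin n → ℝ} → (∀ i → g i ≤ h i) → sum g ≤ sum h
sum-mono-≤ {zero}          g≤h = ≤-reflexive {fromℕ 0} {fromℕ 0} (≈-refl {fromℕ 0})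
sum-mono-≤ {suc n} {g} {h} g≤h =
  +-mono-≤ {g zero} {h zero} {sum (g ∘ suc)} {sum (h ∘ suc)} (g≤h zero) (sum-mono-≤ (g≤h ∘ suc))

sum-cong : ∀ {n} {g h : Fin n → ℝ} → (∀ i → g i ≈ h i) → sum g ≈ sum h
sum-cong {zero}          g≈h = ≈-refl {fromℕ 0}
sum-cong {suc n} {g} {h} g≈h =
  +-cong {g zero} {h zero} {sum (g ∘ suc)} {sum (h ∘ suc)} (g≈h zero) (sum-cong (g≈h ∘ suc))

∑ℚ : ∀ {n} → (Fin n → ℚ) → ℚ
∑ℚ = Vector.foldr ℚ._+_ 0ℚ

-- The common shape of both estimates: fixed real coefficients `a`, `b`, `c` and rational weights
-- depending on the vertex. Only the totals of the weights survive summation.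
sum-affine : ∀ {n} (q r : Fin n → ℚ) a b c →
  seq (sum λ i → a + fromℚ (q i) * b + fromℚ (r i) * c) ≗
  seq (fromℕ n * a + fromℚ (∑ℚ q) * b + fromℚ (∑ℚ r) * c)
sum-affine {zero}  q r a b c k = solve 3 (λ a b c →
  con 0ℚ := con 0ℚ :* a :+ con 0ℚ :* b :+ con 0ℚ :* c) refl (seq a k) (seq b k) (seq c k)
sum-affine {suc n} q r a b c k = begin
  (a′ ℚ.+ q zero ℚ.* b′ ℚ.+ r zero ℚ.* c′) ℚ.+ seq (sum λ i → a + fromℚ (q (suc i)) * b + fromℚ (r (suc i)) * c) k
    ≡⟨ cong (a′ ℚ.+ q zero ℚ.* b′ ℚ.+ r zero ℚ.* c′ ℚ.+_) (sum-affine (q ∘ suc) (r ∘ suc) a b c k) ⟩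
  (a′ ℚ.+ q zero ℚ.* b′ ℚ.+ r zero ℚ.* c′) ℚ.+ (ι n ℚ.* a′ ℚ.+ Q ℚ.* b′ ℚ.+ R ℚ.* c′)
    ≡⟨ solve 8 (λ a b c q r n Q R →
         (a :+ q :* b :+ r :* c) :+ (n :* a :+ Q :* b :+ R :* c)
         := (con 1ℚ :+ n) :* a :+ (q :+ Q) :* b :+ (r :+ R) :* c)
         refl a′ b′ c′ (q zero) (r zero) (ι n) Q R ⟩
  (1ℚ ℚ.+ ι n) ℚ.* a′ ℚ.+ (q zero ℚ.+ Q) ℚ.* b′ ℚ.+ (r zero ℚ.+ R) ℚ.* c′
    ≡⟨ cong (λ m → m ℚ.* a′ ℚ.+ (q zero ℚ.+ Q) ℚ.* b′ ℚ.+ (r zero ℚ.+ R) ℚ.* c′) (ι-suc n) ⟨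
  ι (suc n) ℚ.* a′ ℚ.+ (q zero ℚ.+ Q) ℚ.* b′ ℚ.+ (r zero ℚ.+ R) ℚ.* c′ ∎
  where
  open ≡-Reasoning
  a′ = seq a k
  b′ = seq b k
  c′ = seq c k
  Q = ∑ℚ (q ∘ suc)
  R = ∑ℚ (r ∘ suc)

-- Equality on `[1,∞[` ignores membership proofs, so the two arguments agree even when their proofs
-- of positivity differ.
at-cong : ∀ (f : [1,∞[ ⟶ₛ ℝ-setoid) {k l} (1≤k : 1 ≤ℕ k) (1≤l : 1 ≤ℕ l) →
  k ≡ l → f at k [ 1≤k ] ≈ f at l [ 1≤l ]
at-cong f {k} 1≤k 1≤l refl = Func.cong f (≈-refl {fromℕ k})

convex-at : ∀ (f : [1,∞[ ⟶ₛ ℝ-setoid) → Convex f →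
  ∀ {i j k} (1≤i : 1 ≤ℕ i) (1≤j : 1 ≤ℕ j) (1≤k : 1 ≤ℕ k) w → 0ℚ ℚ.≤ w → w ℚ.≤ 1ℚ →
  ι j ≡ w ℚ.* ι k ℚ.+ (1ℚ ℚ.- w) ℚ.* ι i →
  f at j [ 1≤j ] ≤ fromℚ w * f at k [ 1≤k ] + (fromℕ 1 - fromℚ w) * f at i [ 1≤i ]
convex-at f convex {i} {j} {k} 1≤i 1≤j 1≤k w 0≤w w≤1 eq =
  convex (fromℕ k , fromℕ-mono-≤ 1≤k) (fromℕ i , fromℕ-mono-≤ 1≤i) (fromℕ j , fromℕ-mono-≤ 1≤j)
    (fromℚ w) (fromℚ-mono-≤ {0ℚ} {w} 0≤w) (fromℚ-mono-≤ {w} {1ℚ} w≤1)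
    (≗⇒≈ {fromℕ j} {fromℚ w * fromℕ k + (fromℕ 1 - fromℚ w) * fromℕ i} λ _ → eq)

-- Counting

bit : Bool → ℕ
bit b = if b then 1 else 0

∣tabulate∣ : ∀ {n} (g : Fin n → Bool) → ∣ tabulate g ∣ ≡ ∑ℕ (bit ∘ g)
∣tabulate∣ {zero}  g = refl
∣tabulate∣ {suc n} g with g zero
... | true  = cong suc (∣tabulate∣ (g ∘ suc))
... | false = ∣tabulate∣ (g ∘ suc)

∑-≟ : ∀ {n} (w : Fin n) → ∑ℕ (λ v → bit (does (w ≟ v))) ≡ 1
∑-≟ {suc n} zero    = cong suc (sum-replicate-zero n)
∑-≟ {suc n} (suc w) = ∑-≟ w

∑-1 : ∀ n → ∑ℕ {n} (λ _ → 1) ≡ n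
∑-1 zero    = refl
∑-1 (suc n) = cong suc (∑-1 n)

∈-tabulate⁺ : ∀ {n} {g : Fin n → Bool} {v} → g v ≡ true → v Subset.∈ tabulate g
∈-tabulate⁺ {g = g} {v} gv = Vecₚ.lookup⇒[]= v (tabulate g) (trans (Vecₚ.lookup∘tabulate g v) gv)

∈-tabulate⁻ : ∀ {n} {g : Fin n → Bool} {v} → v Subset.∈ tabulate g → g v ≡ true
∈-tabulate⁻ {g = g} {v} v∈ = trans (sym (Vecₚ.lookup∘tabulate g v)) (Vecₚ.[]=⇒lookup v∈)

-- Deleting the head from `p` strictly lowers its size and, by uniqueness, keeps the tail inside.
Unique⇒length≤∣∣ : ∀ {n} {p : Subset n} {xs} → Unique xs → All (Subset._∈ p) xs → length xs ≤ℕ ∣ p ∣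
Unique⇒length≤∣∣ []       []         = z≤n
Unique⇒length≤∣∣ (x∉xs ∷ uxs) (x∈p ∷ xs⊆p) = ℕₚ.≤-<-trans
  (Unique⇒length≤∣∣ uxs (All.zipWith (λ (x≢y , y∈p) → Subsetₚ.x∈p∧x≢y⇒x∈p-y y∈p (≢-sym x≢y)) (x∉xs , xs⊆p)))
  (Subsetₚ.x∈p⇒∣p-x∣<∣p∣ x∈p)

true-does : ∀ {A : Set} (A? : Dec A) → does A? ≡ true → A
true-does (yes a) _ = a

-- Paths

module _ {A : Set} {R : Rel A 0ℓ} where

  Linked⇒consecutive : ∀ {xs a b} → Linked R xs → Infix _≡_ (a ∷ b ∷ []) xs → R a b
  Linked⇒consecutive (Rab ∷ _)  (here (refl ∷ refl ∷ [])) = Rab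
  Linked⇒consecutive (_ ∷ Rxs) (there i) = Linked⇒consecutive Rxs i
  Linked⇒consecutive [-] (here (_ ∷ ()))
  Linked⇒consecutive [-] (there (here ()))

module _ {A : Set} where

  Consecutive : List A → Rel A 0ℓ
  Consecutive xs a b = Infix _≡_ (a ∷ b ∷ []) xs

  consecutive-head : ∀ {x y : A} ys → Consecutive (x ∷ y ∷ ys) x y
  consecutive-head ys = here (refl ∷ refl ∷ [])

  consecutive-last : ∀ (y : A) ys z → ∃[ a ] (a ∈ y ∷ ys × Consecutive (y ∷ ys ++ [ z ]) a z)
  consecutive-last y []        z = y , here refl , here (refl ∷ refl ∷ [])
  consecutive-last y (y′ ∷ ys) z =
    let a , a∈ , c = consecutive-last y′ ys z in a , there a∈ , there c

  -- The entries just before and just after `u` differ because the list has no repetition.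
  interior-neighbours : ∀ {u : A} x ys z → u ∈ ys → Unique (x ∷ ys ++ [ z ]) →
    ∃₂ λ a b → a ≢ b × Consecutive (x ∷ ys ++ [ z ]) a u × Consecutive (x ∷ ys ++ [ z ]) u b
  interior-neighbours x (y ∷ ys) z (here refl) ((_ ∷ x∉) ∷ _) with ys
  ... | []     = x , z , All.head x∉ , here (refl ∷ refl ∷ []) , there (here (refl ∷ refl ∷ []))
  ... | y′ ∷ _ = x , y′ , All.head x∉ , here (refl ∷ refl ∷ []) , there (here (refl ∷ refl ∷ []))
  interior-neighbours x (y ∷ ys) z (there u∈) (_ ∷ uniq) =
    let a , b , a≢b , c , d = interior-neighbours y ys z u∈ uniq in a , b , a≢b , there c , there d

  -- Rotation of a cycle: with the start moved to the end, the later vertices become interior points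
  -- of a repetition-free list.
  Unique-∷ʳ : ∀ {x : A} {ys} → Unique (x ∷ ys) → Unique (ys ++ [ x ])
  Unique-∷ʳ {ys = []}     _                     = [] ∷ []
  Unique-∷ʳ {ys = y ∷ ys} ((x≢y ∷ x∉) ∷ y∉ ∷ u) =
    Allₚ.++⁺ y∉ (≢-sym x≢y ∷ []) ∷ Unique-∷ʳ (x∉ ∷ u)

module _ {n} (R : Rel (Fin n) 0ℓ) where

  -- The endpoint is a parameter because closing a path into a cycle needs its last vertex.
  data PathTo (v : Fin n) : List (Fin n) → Set where
    [v] : PathTo v [ v ]
    _∷_ : ∀ {x y ys} → R x y → PathTo v (y ∷ ys) → PathTo v (x ∷ y ∷ ys)

module _ {n} {R : Rel (Fin n) 0ℓ} where

  SimplePath : Rel (Fin n) 0ℓ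
  SimplePath x v = ∃[ zs ] (PathTo R v (x ∷ zs) × Unique (x ∷ zs))

  path-suffix : ∀ {x v ys} → x ∈ ys → PathTo R v ys → Unique ys → SimplePath x v
  path-suffix (here refl) p       u       = _ , p , u
  path-suffix (there x∈)  (_ ∷ p) (_ ∷ u) = path-suffix x∈ p u
  path-suffix (there ())  [v]

  -- Loop erasure: when `x` already lies on the simple path from its successor, only the part from
  -- `x` on is kept.
  simplePath : ∀ {x v} → Star R x v → SimplePath x v
  simplePath ε = [] , [v] , [] ∷ []
  simplePath {x} (Rxy ◅ y⟶v) with simplePath y⟶v
  ... | zs , p , u with DecMembership._∈?_ _≟_ x (_ ∷ zs)
  ...   | yes x∈ = path-suffix x∈ p u
  ...   | no x∉  = _ , Rxy ∷ p , Allₚ.¬Any⇒All¬ _ x∉ ∷ u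

  close : ∀ {S : Rel (Fin n) 0ℓ} {v xs w} → R ⇒ S → PathTo R v xs → S v w → Linked S (xs ++ [ w ])
  close R⇒S [v]     Svw = Svw ∷ [-]
  close R⇒S (r ∷ p) Svw = R⇒S r ∷ close R⇒S p Svw

-- Distance to a root.

least : ∀ {P : ℕ → Set} → Unary.Decidable P → ∀ k → P k → ∃[ m ] (P m × (∀ j → P j → m ≤ℕ j))
least P? k Pk with P? 0
least P? k       Pk | yes P0 = 0 , P0 , λ _ _ → z≤n
least P? zero    Pk | no ¬P0 = contradiction Pk ¬P0
least P? (suc k) Pk | no ¬P0 with least (P? ∘ suc) k Pk
... | m , Pm , m≤ = suc m , Pm , λ where
  zero    P0 → contradiction P0 ¬P0
  (suc j) Pj → s≤s (m≤ j Pj)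

module Distance {n} {H : Rel (Fin n) 0ℓ} (H? : Decidable H) {r : Fin n} (reach : ∀ u → Star H u r) where

  -- Asks for a walk of exactly `k` steps, not at most `k`; the least such `k` is the distance all
  -- the same.
  Within : ℕ → Fin n → Set
  Within zero    u = u ≡ r
  Within (suc k) u = ∃[ v ] (H u v × Within k v)

  within? : ∀ k u → Dec (Within k u)
  within? zero    u = u ≟ r
  within? (suc k) u = any? λ v → H? u v ×-dec within? k v

  star⇒within : ∀ {u} → Star H u r → ∃[ k ] Within k u
  star⇒within ε       = 0 , refl
  star⇒within (h ◅ s) = let k , w = star⇒within s in suc k , _ , h , w

  abstract
    least-within : ∀ u → ∃[ m ] (Within m u × (∀ j → Within j u → m ≤ℕ j))
    least-within u = let k , w = star⇒within (reach u) in least (λ j → within? j u) k w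

  dist : Fin n → ℕ
  dist = proj₁ ∘ least-within

  -- The first step of a shortest walk works: the remainder of the walk shows that `v` is nearer to
  -- `r`.
  closer : ∀ u → u ≢ r → ∃[ v ] (H u v × dist v <ℕ dist u)
  closer u u≢r with dist u | proj₁ (proj₂ (least-within u))
  ... | zero  | u≡r         = contradiction u≡r u≢r
  ... | suc k | v , Huv , w = v , Huv , s≤s (proj₂ (proj₂ (least-within v)) k w)

-- Degrees in unicyclic graphs

leaf : ℕ → ℕ
leaf 1 = 1
leaf _ = 0

module _ {n} (G : Graph n) where
  open Graph G using (_~_; _~?_; ~-sym; ~-irrefl; connected; neighbours; Cycle; module Cycle)

  vertices : Cycle → List (Fin n)
  vertices D = Cycle.start D ∷ Cycle.rest D

  -- `S` is kept general: with adjacency it says that cycle edges are edges, and with a smaller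
  -- relation that a cycle avoids certain edges.
  hasEdge⁻ : ∀ {S : Rel (Fin n) 0ℓ} (D : Cycle) → Symmetric S →
    Linked S (Cycle.start D ∷ Cycle.rest D ++ [ Cycle.start D ]) → Cycle.HasEdge D ⇒ S
  hasEdge⁻ D S-sym linked (inj₁ c) = Linked⇒consecutive linked c
  hasEdge⁻ D S-sym linked (inj₂ c) = S-sym (Linked⇒consecutive linked c)

  hasEdge⇒~ : ∀ D → Cycle.HasEdge D ⇒ _~_
  hasEdge⇒~ D = hasEdge⁻ D ~-sym (Cycle.adjacent D)

  ∈-neighbours : ∀ {u v} → u ~ v → v Subset.∈ neighbours u
  ∈-neighbours {u} {v} u~v = ∈-tabulate⁺ (dec-true (u ~? v) u~v)

  ∈-neighbours⁻ : ∀ {u v} → v Subset.∈ neighbours u → u ~ v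
  ∈-neighbours⁻ {u} {v} v∈ = true-does (u ~? v) (∈-tabulate⁻ v∈)

  -- The two are the predecessor and the successor along the cycle. They differ because at least
  -- three distinct vertices lie on it.
  two-neighbours : ∀ D {u} → u ∈ vertices D →
    ∃₂ λ a b → a ≢ b × Cycle.HasEdge D u a × Cycle.HasEdge D u b
  two-neighbours record { start = s ; rest = [] ; length≥3 = s≤s () }
  two-neighbours record { start = s ; rest = y ∷ [] ; length≥3 = s≤s (s≤s ()) }
  -- For the start vertex the predecessor is the last entry of `rest`.
  two-neighbours record { start = s ; rest = y ∷ y′ ∷ ys ; distinct = _ ∷ y∉ ∷ _ } (here refl) =
    let a , a∈ , c = consecutive-last y′ ys s
    in y , a , All.lookup y∉ a∈ , inj₁ (consecutive-head _) , inj₂ (there (there c))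
  two-neighbours record { start = s ; rest = y ∷ y′ ∷ ys ; distinct = (_ ∷ s≢y′ ∷ _) ∷ _ } (there (here refl)) =
    s , y′ , s≢y′ , inj₂ (consecutive-head _) , inj₁ (there (consecutive-head _))
  -- From the third vertex on, both neighbours lie in the rotated list, which ends in `s`.
  two-neighbours record { start = s ; rest = y ∷ y′ ∷ ys ; distinct = distinct } (there (there u∈)) =
    let a , b , a≢b , c , d = interior-neighbours y (y′ ∷ ys) s u∈ (Unique-∷ʳ distinct)
    in a , b , a≢b , inj₂ (there c) , inj₁ (there d)

  cycle-degree : ∀ D {u} → u ∈ vertices D → 2 ≤ℕ degree G u
  cycle-degree D u∈ =
    let a , b , a≢b , ua , ub = two-neighbours D u∈
    in Unique⇒length≤∣∣ ((a≢b ∷ []) ∷ [] ∷ [])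
         (∈-neighbours (hasEdge⇒~ D ua) ∷ ∈-neighbours (hasEdge⇒~ D ub) ∷ [])

  -- A degree of `n` would make `u` its own neighbour.
  degree<n : ∀ u → degree G u <ℕ n
  degree<n u = ℕₚ.≤∧≢⇒< (Subsetₚ.∣p∣≤n (neighbours u)) λ eq →
    ~-irrefl refl (∈-neighbours⁻ (subst (u Subset.∈_) (sym (Subsetₚ.∣p∣≡n⇒p≡⊤ eq)) Subsetₚ.∈⊤))

  -- Vertices of the cycle have degree at least 2, so at least three vertices are not leaves; leaves
  -- and non-leaves together number `n`.
  leaves+3≤n : Cycle → ∑ℕ (leaf ∘ degree G) ℕ.+ 3 ≤ℕ n
  leaves+3≤n D = begin
    ∑ℕ (leaf ∘ degree G) ℕ.+ 3
      ≤⟨ ℕₚ.+-monoʳ-≤ (∑ℕ (leaf ∘ degree G)) (ℕₚ.≤-trans (Cycle.length≥3 D)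
           (Unique⇒length≤∣∣ (Cycle.distinct D)
             (All.tabulate λ {u} u∈ → ∈-tabulate⁺ (dec-true (2 ℕₚ.≤? degree G u) (cycle-degree D u∈))))) ⟩
    ∑ℕ (leaf ∘ degree G) ℕ.+ ∣ tabulate nonLeaf ∣
      ≡⟨ cong (∑ℕ (leaf ∘ degree G) ℕ.+_) (∣tabulate∣ nonLeaf) ⟩
    ∑ℕ (leaf ∘ degree G) ℕ.+ ∑ℕ (bit ∘ nonLeaf)
      ≡⟨ ∑-distrib-+ (leaf ∘ degree G) (bit ∘ nonLeaf) ⟨
    ∑ℕ (λ u → leaf (degree G u) ℕ.+ bit (nonLeaf u))
      ≡⟨ ∑ℕ-cong (λ u → leaf+nonLeaf (1≤degree G u)) ⟩
    ∑ℕ {n} (λ _ → 1)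
      ≡⟨ ∑-1 n ⟩
    n ∎
    where
    open ℕₚ.≤-Reasoning
    nonLeaf : Fin n → Bool
    nonLeaf u = does (2 ℕₚ.≤? degree G u)
    leaf+nonLeaf : ∀ {d} → 1 ≤ℕ d → leaf d ℕ.+ bit (does (2 ℕₚ.≤? d)) ≡ 1
    leaf+nonLeaf {suc zero}    _ = refl
    leaf+nonLeaf {suc (suc d)} _ = refl

  -- Orient each edge from `u` to `π u`. Every edge has exactly one orientation and every vertex
  -- exactly one outgoing arc, so outgoing and incoming arcs number `n` each.
  handshake : (π : Fin n → Fin n) → (∀ u → u ~ π u) → (∀ u → π (π u) ≢ u) →
    (∀ {u v} → u ~ v → π u ≡ v ⊎ π v ≡ u) → ∑ℕ (degree G) ≡ n ℕ.+ n
  handshake π ~π ππ≢ edge = begin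
    ∑ℕ (degree G)
      ≡⟨ ∑ℕ-cong (λ u → trans (∣tabulate∣ (does ∘ (u ~?_))) (trans (∑ℕ-cong (split u)) (∑-distrib-+ (out u) (inn u)))) ⟩
    ∑ℕ (λ u → ∑ℕ (out u) ℕ.+ ∑ℕ (inn u))
      ≡⟨ ∑-distrib-+ (λ u → ∑ℕ (out u)) (λ u → ∑ℕ (inn u)) ⟩
    ∑ℕ (λ u → ∑ℕ (out u)) ℕ.+ ∑ℕ (λ u → ∑ℕ (inn u))
      ≡⟨ cong (∑ℕ (λ u → ∑ℕ (out u)) ℕ.+_) (∑-comm inn) ⟩
    ∑ℕ (λ u → ∑ℕ (out u)) ℕ.+ ∑ℕ (λ v → ∑ℕ (out v))
      ≡⟨ cong₂ ℕ._+_ ∑out ∑out ⟩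
    n ℕ.+ n ∎
    where
    open ≡-Reasoning
    out inn : Fin n → Fin n → ℕ
    out u v = bit (does (π u ≟ v))
    inn u v = bit (does (π v ≟ u))
    ∑out : ∑ℕ (λ u → ∑ℕ (out u)) ≡ n
    ∑out = trans (∑ℕ-cong (∑-≟ ∘ π)) (∑-1 n)
    split : ∀ u v → bit (does (u ~? v)) ≡ out u v ℕ.+ inn u v
    split u v with u ~? v | π u ≟ v | π v ≟ u
    -- An edge oriented both ways would be a 2-cycle of `π`.
    ... | _       | yes refl | yes ππu≡u = contradiction ππu≡u (ππ≢ u)
    ... | yes _   | yes _    | no _      = refl
    ... | yes _   | no _     | yes _     = refl
    ... | yes u~v | no πu≢v  | no πv≢u   = contradiction (edge u~v) [ πu≢v , πv≢u ]′
    ... | no u≁v  | yes refl | no _      = contradiction (~π u) u≁v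
    ... | no u≁v  | no _     | yes refl  = contradiction (~-sym (~π v)) u≁v
    ... | no _    | no _     | no _      = refl

  -- Shorten the walk to a simple path. It has at least two edges, since `u ~ u` is impossible and
  -- `R u v` is excluded, so the edge from `v` back to `u` completes a cycle.
  chord-cycle : ∀ {R S : Rel (Fin n) 0ℓ} → R ⇒ S → S ⇒ _~_ → Symmetric S →
    ∀ {u v} → Star R u v → ¬ R u v → S v u → Σ[ D ∈ Cycle ] (Cycle.HasEdge D ⇒ S)
  chord-cycle R⇒S S⇒~ S-sym {u} {v} u⟶v ¬Ruv Svu with simplePath u⟶v
  ... | []          , [v]       , _ = contradiction (S⇒~ Svu) (~-irrefl refl)
  ... | _ ∷ []      , Ruv ∷ [v] , _ = contradiction Ruv ¬Ruv
  ... | a ∷ b ∷ zs  , p         , uniq = D , hasEdge⁻ D S-sym linked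
    where
    linked = close R⇒S p Svu
    D : Cycle
    D = record { start = u ; rest = a ∷ b ∷ zs ; length≥3 = s≤s (s≤s (s≤s z≤n))
               ; distinct = uniq ; adjacent = Linked.map S⇒~ linked }

  -- Spanning tree after removal of a cycle edge.

  module _ {r r′ r″ : Fin n} {rs : List (Fin n)}
    (distinct : Unique (r ∷ r′ ∷ r″ ∷ rs)) (adjacent : Linked _~_ (r ∷ r′ ∷ r″ ∷ rs ++ [ r ]))
    (unique : ∀ D → Cycle.HasEdge D r r′) where

    r≢r′ : r ≢ r′
    r≢r′ = All.head (AllPairs.head distinct)

    Removed : Rel (Fin n) 0ℓ
    Removed u v = (u ≡ r × v ≡ r′) ⊎ (u ≡ r′ × v ≡ r)

    removed? : Decidable Removed
    removed? u v = ((u ≟ r) ×-dec (v ≟ r′)) ⊎-dec ((u ≟ r′) ×-dec (v ≟ r))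

    H : Rel (Fin n) 0ℓ
    H u v = u ~ v × ¬ Removed u v

    H-sym : Symmetric H
    H-sym (u~v , kept) = ~-sym u~v , λ where
      (inj₁ (a , b)) → kept (inj₂ (b , a))
      (inj₂ (a , b)) → kept (inj₁ (b , a))

    -- A removed edge starts at `r` or `r′`, and no step of this path does.
    path-kept : ∀ {x xs} → All (λ y → y ≢ r × y ≢ r′) (x ∷ xs) →
      Linked _~_ (x ∷ xs ++ [ r ]) → Star H x r
    path-kept {xs = []}    ((≢r , ≢r′) ∷ _)  (x~r ∷ _)  =
      (x~r , [ ≢r ∘ proj₁ , ≢r′ ∘ proj₁ ]′) ◅ ε
    path-kept {xs = _ ∷ _} ((≢r , ≢r′) ∷ ok) (x~y ∷ ls) =
      (x~y , [ ≢r ∘ proj₁ , ≢r′ ∘ proj₁ ]′) ◅ path-kept ok ls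

    -- The long way round the cycle. Its first step is kept because `r″` differs from `r`.
    r′⟶r : Star H r′ r
    r′⟶r =
      (Linked.head ls , [ r≢r′ ∘ sym ∘ proj₁ , All.head r≢ ∘ sym ∘ proj₂ ]′) ◅
      path-kept (All.zipWith (λ (p , q) → ≢-sym p , ≢-sym q) (r≢ , r′≢)) (Linked.tail ls)
      where
      ls = Linked.tail adjacent
      r≢ = All.tail (AllPairs.head distinct)
      r′≢ = AllPairs.head (AllPairs.tail distinct)

    -- Each use of the removed edge is replaced by the long way round the cycle.
    H-connected : ∀ u → Star H u r
    H-connected u = (reroute Star.⋆) (connected u r)
      where
      reroute : _~_ ⇒ Star H
      reroute {u} {v} u~v with removed? u v
      ... | no kept                  = (u~v , kept) ◅ ε
      ... | yes (inj₁ (refl , refl)) = Star.reverse H-sym r′⟶r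
      ... | yes (inj₂ (refl , refl)) = r′⟶r

    open Distance {H = H} (λ u v → (u ~? v) ×-dec ¬? (removed? u v)) H-connected

    -- The defining properties are packed with the vertex, so that later arguments need no unfolding
    -- of the test for the root.
    parent : ∀ u → ∃[ v ] ((u ≡ r → v ≡ r′) × (u ≢ r → H u v × dist v <ℕ dist u))
    parent u with u ≟ r
    ... | yes u≡r = r′ , (λ _ → refl) , λ u≢r → contradiction u≡r u≢r
    ... | no u≢r  = proj₁ (closer u u≢r) , (λ u≡r → contradiction u≡r u≢r) , λ _ → proj₂ (closer u u≢r)

    π : Fin n → Fin n
    π = proj₁ ∘ parent

    π-root : π r ≡ r′
    π-root = proj₁ (proj₂ (parent r)) refl

    π-closer : ∀ {u} → u ≢ r → H u (π u) × dist (π u) <ℕ dist u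
    π-closer {u} = proj₂ (proj₂ (parent u))

    r~r′ : r ~ r′
    r~r′ = Linked.head adjacent

    ~π : ∀ u → u ~ π u
    ~π u = go (u ≟ r)
      where
      go : Dec (u ≡ r) → u ~ π u
      go (yes refl) = subst (r ~_) (sym π-root) r~r′
      go (no u≢r)   = proj₁ (proj₁ (π-closer u≢r))

    -- `π r` is `r′`, and the parent of `r′` is reached along an edge other than the removed one.
    ππr≢r : π (π r) ≢ r
    ππr≢r ππr≡r = proj₂ (proj₁ (π-closer (≢-sym r≢r′)))
      (inj₂ (refl , trans (cong π (sym π-root)) ππr≡r))

    -- Away from the root two steps of `π` strictly decrease the distance. If `u` or `π u` is the
    -- root, the claim comes down to the case of `r`.
    ππ≢ : ∀ u → π (π u) ≢ u
    ππ≢ u ππu≡u = go (u ≟ r) (π u ≟ r)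
      where
      go : Dec (u ≡ r) → Dec (π u ≡ r) → ⊥
      go (yes refl) _          = ππr≢r ππu≡u
      -- From `π u ≡ r` and `π (π u) ≡ u` it follows that `π r ≡ u`, whence `π (π r) ≡ r`.
      go (no _)     (yes πu≡r) = ππr≢r (trans (cong π (trans (cong π (sym πu≡r)) ππu≡u)) πu≡r)
      go (no u≢r)   (no πu≢r)  = ℕₚ.<-asym (proj₂ (π-closer u≢r))
        (subst (λ w → dist w <ℕ dist (π u)) ππu≡u (proj₂ (π-closer πu≢r)))

    -- Requiring a non-root child drops the arc from `r` to `r′`, so the removed edge is absent.
    Tree : Rel (Fin n) 0ℓ
    Tree u v = (u ≢ r × π u ≡ v) ⊎ (v ≢ r × π v ≡ u)

    -- Following parents terminates because the distance to `r` decreases.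
    tree-path : ∀ u → Star Tree u r
    tree-path u = go u (<-wellFounded (dist u))
      where
      go : ∀ u → Acc _<ℕ_ (dist u) → Star Tree u r
      go u (acc rec) with u ≟ r
      ... | yes refl = ε
      ... | no u≢r   = inj₁ (u≢r , refl) ◅ go (π u) (rec (proj₂ (π-closer u≢r)))

    ¬Tree-removed : ¬ Tree r r′
    ¬Tree-removed (inj₁ (r≢r , _))      = r≢r refl
    ¬Tree-removed (inj₂ (r′≢r , πr′≡r)) = proj₂ (proj₁ (π-closer r′≢r)) (inj₂ (refl , πr′≡r))

    Tree⇒~ : Tree ⇒ _~_
    Tree⇒~ (inj₁ (_ , refl)) = ~π _
    Tree⇒~ (inj₂ (_ , refl)) = ~-sym (~π _)

    -- An edge uv outside the functional graph of π would close a cycle with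
    -- the tree path from u to v, and that cycle avoids the edge rr′.
    edge⇒π : ∀ {u v} → u ~ v → π u ≡ v ⊎ π v ≡ u
    edge⇒π {u} {v} u~v with π u ≟ v | π v ≟ u
    ... | yes πu≡v | _        = inj₁ πu≡v
    ... | _        | yes πv≡u = inj₂ πv≡u
    ... | no πu≢v  | no πv≢u  = contradiction (proj₂ chord (unique (proj₁ chord))) ¬S-removed
      where
      S : Rel (Fin n) 0ℓ
      S a b = Tree a b ⊎ ((a ≡ u × b ≡ v) ⊎ (a ≡ v × b ≡ u))
      S-sym : Symmetric S
      S-sym (inj₁ t)              = inj₁ (swap t)
      S-sym (inj₂ (inj₁ (p , q))) = inj₂ (inj₂ (q , p))
      S-sym (inj₂ (inj₂ (p , q))) = inj₂ (inj₁ (q , p))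
      S⇒~ : S ⇒ _~_
      S⇒~ (inj₁ t)                    = Tree⇒~ t
      S⇒~ (inj₂ (inj₁ (refl , refl))) = u~v
      S⇒~ (inj₂ (inj₂ (refl , refl))) = ~-sym u~v
      ¬S-removed : ¬ S r r′
      ¬S-removed (inj₁ t)                    = ¬Tree-removed t
      -- Were uv the edge rr′, the value of `π` at the root would already account for it.
      ¬S-removed (inj₂ (inj₁ (refl , refl))) = πu≢v π-root
      ¬S-removed (inj₂ (inj₂ (refl , refl))) = πv≢u π-root
      chord : Σ[ D ∈ Cycle ] (Cycle.HasEdge D ⇒ S)
      chord = chord-cycle {Tree} {S} inj₁ S⇒~ S-sym
        (tree-path u ◅◅ Star.reverse swap (tree-path v))
        [ πu≢v ∘ proj₂ , πv≢u ∘ proj₂ ]′ (inj₂ (inj₂ (refl , refl)))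

  unicyclic⇒∑degree : Unicyclic G → ∑ℕ (degree G) ≡ n ℕ.+ n
  unicyclic⇒∑degree (record { start = r ; rest = [] ; length≥3 = s≤s () } , _)
  unicyclic⇒∑degree (record { start = r ; rest = _ ∷ [] ; length≥3 = s≤s (s≤s ()) } , _)
  unicyclic⇒∑degree (record { start = r ; rest = r′ ∷ r″ ∷ rs ; distinct = distinct ; adjacent = adjacent } , same) =
    handshake (π distinct adjacent unique) (~π distinct adjacent unique)
      (ππ≢ distinct adjacent unique) (edge⇒π distinct adjacent unique)
    where
    unique : ∀ D → Cycle.HasEdge D r r′
    -- This is where uniqueness enters: every cycle has the edge set of the given one, hence its
    -- first edge.
    unique D = Equivalence.from (same D r r′) (inj₁ (consecutive-head _))

-- Convexity

-- Together with `0≤ι*1/ι` it makes a/(m+1) an admissible weight for convexity.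
ι*1/ι≤1 : ∀ {a} m → a ≤ℕ suc m → ι a ℚ.* 1/ι m ℚ.≤ 1ℚ
ι*1/ι≤1 {a} m a≤1+m = subst (ι a ℚ.* 1/ι m ℚ.≤_) (ι*1/ι m)
  (ℚₚ.*-monoʳ-≤-nonNeg (1/ι m) {{ℚₚ.pos⇒nonNeg (1/ι m) {{1/ι-positive m}}}} ι-mono)
  where
  ι-mono : ι a ℚ.≤ ι (suc m)
  ι-mono = subst₂ ℚ._≤_ (ℚₚ.+-identityʳ (ι a))
    (trans (sym (ι-+ a (suc m ∸ a))) (cong ι (ℕₚ.m+[n∸m]≡n a≤1+m)))
    (ℚₚ.+-monoʳ-≤ (ι a) (ι-nonNegative (suc m ∸ a)))

0≤ι*1/ι : ∀ a m → 0ℚ ℚ.≤ ι a ℚ.* 1/ι m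
0≤ι*1/ι a m = subst (ℚ._≤ ι a ℚ.* 1/ι m) (ℚₚ.*-zeroˡ (1/ι m))
  (ℚₚ.*-monoʳ-≤-nonNeg (1/ι m) {{ℚₚ.pos⇒nonNeg (1/ι m) {{1/ι-positive m}}}} (ι-nonNegative a))

∑ι : ∀ {n} (d : Fin n → ℕ) → ∑ℚ (ι ∘ d) ≡ ι (∑ℕ d)
∑ι {zero}  d = refl
∑ι {suc n} d = trans (cong (ι (d zero) ℚ.+_) (∑ι (d ∘ suc))) (sym (ι-+ (d zero) (∑ℕ (d ∘ suc))))

-- The total deviation from degree 2, which vanishes when the degrees sum to twice `n`.
∑ι-2 : ∀ {n} (d : Fin n → ℕ) → ∑ℚ (λ u → ι (d u) ℚ.- ι 2) ≡ ι (∑ℕ d) ℚ.- (ι n ℚ.+ ι n)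
∑ι-2 {zero}  d = refl
∑ι-2 {suc n} d = begin
  (ι d₀ ℚ.- ι 2) ℚ.+ ∑ℚ (λ u → ι (d (suc u)) ℚ.- ι 2)
    ≡⟨ cong (ι d₀ ℚ.- ι 2 ℚ.+_) (∑ι-2 (d ∘ suc)) ⟩
  (ι d₀ ℚ.- ι 2) ℚ.+ (ι D ℚ.- (ι n ℚ.+ ι n))
    ≡⟨ solve 3 (λ a b n → (a :- con (ι 2)) :+ (b :- (n :+ n))
         := (a :+ b) :- ((con 1ℚ :+ n) :+ (con 1ℚ :+ n))) refl (ι d₀) (ι D) (ι n) ⟩
  (ι d₀ ℚ.+ ι D) ℚ.- ((1ℚ ℚ.+ ι n) ℚ.+ (1ℚ ℚ.+ ι n))
    ≡⟨ cong₂ (λ s t → s ℚ.- (t ℚ.+ t)) (ι-+ d₀ D) (ι-suc n) ⟨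
  ι (d₀ ℕ.+ D) ℚ.- (ι (suc n) ℚ.+ ι (suc n)) ∎
  where
  open ≡-Reasoning
  d₀ = d zero
  D = ∑ℕ (d ∘ suc)

module ConvexBounds (f : [1,∞[ ⟶ₛ ℝ-setoid) (convex : Convex f) where

  f1 f2 : ℝ
  f1 = f at 1 [ s≤s z≤n ]
  f2 = f at 2 [ s≤s z≤n ]

  -- Convexity with weight a/(m+1) on the right endpoint, rewritten as the value at `i` plus `a`
  -- times the slope of the chord.
  below-chord : ∀ i a m (1≤i : 1 ≤ℕ i) (1≤j : 1 ≤ℕ i ℕ.+ a) (1≤k : 1 ≤ℕ i ℕ.+ suc m) → a ≤ℕ suc m →
    f at i ℕ.+ a [ 1≤j ] ≤
    f at i [ 1≤i ] + fromℕ a * (fromℚ (1/ι m) * (f at i ℕ.+ suc m [ 1≤k ] - f at i [ 1≤i ]))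
  below-chord i a m 1≤i 1≤j 1≤k a≤1+m =
    ≤-rescale {fj} {fromℚ w * fk + (fromℕ 1 - fromℚ w) * fi} {fj}
      {fi + fromℕ a * (fromℚ (1/ι m) * (fk - fi))} 1ℚ
      (λ l → solve 5 (λ a v x y z →
         con 1ℚ :* (((a :* v) :* z :+ (con 1ℚ :- a :* v) :* x) :- y)
         := (x :+ a :* (v :* (z :- x))) :- y)
         refl (ι a) (1/ι m) (seq fi l) (seq fj l) (seq fk l))
      (convex-at f convex 1≤i 1≤j 1≤k w (0≤ι*1/ι a m) (ι*1/ι≤1 m a≤1+m) eq)
    where
    fi = f at i [ 1≤i ]
    fj = f at i ℕ.+ a [ 1≤j ]
    fk = f at i ℕ.+ suc m [ 1≤k ]
    w = ι a ℚ.* 1/ι m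
    open ≡-Reasoning
    eq : ι (i ℕ.+ a) ≡ w ℚ.* ι (i ℕ.+ suc m) ℚ.+ (1ℚ ℚ.- w) ℚ.* ι i
    eq = begin
      ι (i ℕ.+ a)
        ≡⟨ ι-+ i a ⟩
      ι i ℚ.+ ι a
        ≡⟨ solve 2 (λ i a → i :+ a := i :+ a :* con 1ℚ) refl (ι i) (ι a) ⟩
      ι i ℚ.+ ι a ℚ.* 1ℚ
        ≡⟨ cong (λ u → ι i ℚ.+ ι a ℚ.* u) (ι*1/ι m) ⟨
      ι i ℚ.+ ι a ℚ.* (ι (suc m) ℚ.* 1/ι m)
        ≡⟨ solve 4 (λ i a c v → i :+ a :* (c :* v)
             := (a :* v) :* (i :+ c) :+ (con 1ℚ :- a :* v) :* i) refl (ι i) (ι a) (ι (suc m)) (1/ι m) ⟩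
      w ℚ.* (ι i ℚ.+ ι (suc m)) ℚ.+ (1ℚ ℚ.- w) ℚ.* ι i
        ≡⟨ cong (λ u → w ℚ.* u ℚ.+ (1ℚ ℚ.- w) ℚ.* ι i) (ι-+ i (suc m)) ⟨
      w ℚ.* ι (i ℕ.+ suc m) ℚ.+ (1ℚ ℚ.- w) ℚ.* ι i ∎

  -- At d = 1 both sides agree. Otherwise 2 lies in the interval from 1 to `d`, and the chord bound
  -- at 2, multiplied by d-1 and rearranged, is the claim.
  above-line : ∀ d (1≤d : 1 ≤ℕ d) →
    f2 + fromℚ (ι d ℚ.- ι 2) * (f2 - f1) ≤ f at d [ 1≤d ]
  above-line (suc zero) (s≤s z≤n) = ≤-reflexive {f2 + fromℚ (ι 1 ℚ.- ι 2) * (f2 - f1)} {f1}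
    (≗⇒≈ {f2 + fromℚ (ι 1 ℚ.- ι 2) * (f2 - f1)} {f1} λ k →
      solve 2 (λ x y → y :+ con (ι 1 ℚ.- ι 2) :* (y :- x) := x) refl (seq f1 k) (seq f2 k))
  above-line (suc (suc m)) 1≤d@(s≤s z≤n) =
    ≤-rescale {f2} {f1 + fromℕ 1 * (fromℚ (1/ι m) * (fd - f1))}
      {f2 + fromℚ (ι (2 ℕ.+ m) ℚ.- ι 2) * (f2 - f1)} {fd} (ι (suc m)) {{ι-positive m}}
      (λ k → eq (seq f1 k) (seq f2 k) (seq fd k))
      (below-chord 1 1 m (s≤s z≤n) (s≤s z≤n) 1≤d (s≤s z≤n))
    where
    fd = f at suc (suc m) [ 1≤d ]
    c = ι (suc m)
    v = 1/ι m
    open ≡-Reasoning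
    eq : ∀ x y z → c ℚ.* ((x ℚ.+ ι 1 ℚ.* (v ℚ.* (z ℚ.- x))) ℚ.- y) ≡
      z ℚ.- (y ℚ.+ (ι (2 ℕ.+ m) ℚ.- ι 2) ℚ.* (y ℚ.- x))
    eq x y z = begin
      c ℚ.* ((x ℚ.+ ι 1 ℚ.* (v ℚ.* (z ℚ.- x))) ℚ.- y)
        ≡⟨ solve 5 (λ c v x y z → c :* ((x :+ con (ι 1) :* (v :* (z :- x))) :- y)
             := c :* (x :- y) :+ (c :* v) :* (z :- x)) refl c v x y z ⟩
      c ℚ.* (x ℚ.- y) ℚ.+ (c ℚ.* v) ℚ.* (z ℚ.- x)
        ≡⟨ cong (λ u → c ℚ.* (x ℚ.- y) ℚ.+ u ℚ.* (z ℚ.- x)) (ι*1/ι m) ⟩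
      c ℚ.* (x ℚ.- y) ℚ.+ 1ℚ ℚ.* (z ℚ.- x)
        ≡⟨ solve 4 (λ c x y z → c :* (x :- y) :+ con 1ℚ :* (z :- x)
             := z :- (y :+ ((con 1ℚ :+ c) :- con (ι 2)) :* (y :- x))) refl c x y z ⟩
      z ℚ.- (y ℚ.+ ((1ℚ ℚ.+ c) ℚ.- ι 2) ℚ.* (y ℚ.- x))
        ≡⟨ cong (λ u → z ℚ.- (y ℚ.+ (u ℚ.- ι 2) ℚ.* (y ℚ.- x))) (ι-suc (suc m)) ⟨
      z ℚ.- (y ℚ.+ (ι (2 ℕ.+ m) ℚ.- ι 2) ℚ.* (y ℚ.- x)) ∎

  module _ (m : ℕ) where

    -- Here n = m+4, so `slope` belongs to the chord from 2 to n-1, and `excess` is the height of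
    -- `f1` above that chord extended to 1.
    fN slope excess : ℝ
    fN = f at 3 ℕ.+ m [ s≤s z≤n ]
    slope = fromℚ (1/ι m) * (fN - f2)
    excess = f1 - f2 + slope

    -- This is `above-line` at n-1 divided by m+1: the chord from 2 to n-1 is at least as steep as
    -- the one from 1 to 2.
    0≤excess : fromℕ 0 ≤ excess
    0≤excess = ≤-rescale {f2 + fromℚ (ι (3 ℕ.+ m) ℚ.- ι 2) * (f2 - f1)} {fN} {fromℕ 0} {excess}
      (1/ι m) {{1/ι-positive m}} (λ k → eq (seq f1 k) (seq f2 k) (seq fN k))
      (above-line (3 ℕ.+ m) (s≤s z≤n))
      where
      c = ι (suc m)
      v = 1/ι m
      open ≡-Reasoning
      eq : ∀ x y z → v ℚ.* (z ℚ.- (y ℚ.+ (ι (3 ℕ.+ m) ℚ.- ι 2) ℚ.* (y ℚ.- x))) ≡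
        ((x ℚ.- y) ℚ.+ v ℚ.* (z ℚ.- y)) ℚ.- ι 0
      eq x y z = begin
        v ℚ.* (z ℚ.- (y ℚ.+ (ι (3 ℕ.+ m) ℚ.- ι 2) ℚ.* (y ℚ.- x)))
          ≡⟨ cong (λ u → v ℚ.* (z ℚ.- (y ℚ.+ (u ℚ.- ι 2) ℚ.* (y ℚ.- x)))) (ι-+ 2 (suc m)) ⟩
        v ℚ.* (z ℚ.- (y ℚ.+ ((ι 2 ℚ.+ c) ℚ.- ι 2) ℚ.* (y ℚ.- x)))
          ≡⟨ solve 5 (λ c v x y z → v :* (z :- (y :+ ((con (ι 2) :+ c) :- con (ι 2)) :* (y :- x)))
               := v :* (z :- y) :- (c :* v) :* (y :- x)) refl c v x y z ⟩
        v ℚ.* (z ℚ.- y) ℚ.- (c ℚ.* v) ℚ.* (y ℚ.- x)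
          ≡⟨ cong (λ u → v ℚ.* (z ℚ.- y) ℚ.- u ℚ.* (y ℚ.- x)) (ι*1/ι m) ⟩
        v ℚ.* (z ℚ.- y) ℚ.- 1ℚ ℚ.* (y ℚ.- x)
          ≡⟨ solve 4 (λ v x y z → v :* (z :- y) :- con 1ℚ :* (y :- x)
               := ((x :- y) :+ v :* (z :- y)) :- con (ι 0)) refl v x y z ⟩
        ((x ℚ.- y) ℚ.+ v ℚ.* (z ℚ.- y)) ℚ.- ι 0 ∎

    -- The two sides differ by `q ∸ p` copies of `excess`. A zero difference is treated apart
    -- because `≤-rescale` wants a positive factor.
    scaled-excess-mono : ∀ {p q} → p ≤ℕ q → fromℕ p * excess ≤ fromℕ q * excess
    scaled-excess-mono {p} {q} p≤q =
      subst (λ r → fromℕ p * excess ≤ fromℕ r * excess) (ℕₚ.m∸n+n≡m p≤q) (go (q ∸ p))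
      where
      go : ∀ l → fromℕ p * excess ≤ fromℕ (l ℕ.+ p) * excess
      go zero    = ≤-reflexive {fromℕ p * excess} {fromℕ p * excess} (≈-refl {fromℕ p * excess})
      go (suc l) = ≤-rescale {fromℕ 0} {excess} {fromℕ p * excess} {fromℕ (suc l ℕ.+ p) * excess}
        (ι (suc l)) {{ι-positive l}}
        (λ k → trans
          (solve 3 (λ L P e → L :* (e :- con (ι 0)) := (L :+ P) :* e :- P :* e) refl
            (ι (suc l)) (ι p) (seq excess k))
          (cong (λ u → u ℚ.* seq excess k ℚ.- ι p ℚ.* seq excess k) (sym (ι-+ (suc l) p))))
        0≤excess

    -- At degree 1 the correction makes this an equality; from 2 to n-1 it is the chord bound, and
    -- the correction has weight 0.
    below-line : ∀ d (1≤d : 1 ≤ℕ d) → d ≤ℕ 3 ℕ.+ m →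
      f at d [ 1≤d ] ≤ f2 + fromℚ (ι d ℚ.- ι 2) * slope + fromℚ (ι (leaf d)) * excess
    below-line (suc zero) (s≤s z≤n) d≤ = ≤-reflexive {f1} {rhs} (≗⇒≈ {f1} {rhs} λ k →
      solve 3 (λ x y s → x := y :+ con (ι 1 ℚ.- ι 2) :* s :+ con (ι 1) :* (x :- y :+ s))
        refl (seq f1 k) (seq f2 k) (seq slope k))
      where rhs = f2 + fromℚ (ι 1 ℚ.- ι 2) * slope + fromℚ (ι 1) * excess
    below-line (suc (suc a)) 1≤d@(s≤s z≤n) (s≤s (s≤s a≤1+m)) =
      ≤-rescale {fd} {f2 + fromℕ a * slope} {fd} {rhs} 1ℚ
        (λ k → trans
          (solve 5 (λ y s a e z → con 1ℚ :* ((y :+ a :* s) :- z)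
             := (y :+ ((con (ι 2) :+ a) :- con (ι 2)) :* s :+ con (ι 0) :* e) :- z)
             refl (seq f2 k) (seq slope k) (ι a) (seq excess k) (seq fd k))
          (cong (λ u → (seq f2 k ℚ.+ (u ℚ.- ι 2) ℚ.* seq slope k ℚ.+ ι 0 ℚ.* seq excess k) ℚ.- seq fd k)
            (sym (ι-+ 2 a))))
        (below-chord 2 a m (s≤s z≤n) 1≤d (s≤s z≤n) a≤1+m)
      where
      fd = f at suc (suc a) [ 1≤d ]
      rhs = f2 + fromℚ (ι (2 ℕ.+ a) ℚ.- ι 2) * slope + fromℚ (ι 0) * excess

  -- Summation over a degree sequence.

  module _ {n} (d : Fin n → ℕ) (1≤d : ∀ u → 1 ≤ℕ d u) (∑d≡n+n : ∑ℕ d ≡ n ℕ.+ n) where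

    Σf : ℝ
    Σf = sum (λ u → f at d u [ 1≤d u ])

    ∑[d-2]≡0 : ∑ℚ (λ u → ι (d u) ℚ.- ι 2) ≡ 0ℚ
    ∑[d-2]≡0 = begin
      ∑ℚ (λ u → ι (d u) ℚ.- ι 2)       ≡⟨ ∑ι-2 d ⟩
      ι (∑ℕ d) ℚ.- (ι n ℚ.+ ι n)       ≡⟨ cong (λ k → ι k ℚ.- (ι n ℚ.+ ι n)) ∑d≡n+n ⟩
      ι (n ℕ.+ n) ℚ.- (ι n ℚ.+ ι n)    ≡⟨ cong (ℚ._- (ι n ℚ.+ ι n)) (ι-+ n n) ⟩
      (ι n ℚ.+ ι n) ℚ.- (ι n ℚ.+ ι n)  ≡⟨ ℚₚ.+-inverseʳ (ι n ℚ.+ ι n) ⟩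
      0ℚ                               ∎
      where open ≡-Reasoning

    -- Summing `above-line` leaves only the constant term, because the deviations from 2 cancel.
    lower-bound : fromℕ n * f2 ≤ Σf
    lower-bound = ≤-trans {fromℕ n * f2} {sum line} {Σf}
      (≤-reflexive {fromℕ n * f2} {sum line} (≗⇒≈ {fromℕ n * f2} {sum line} λ k → sym (eq k)))
      (sum-mono-≤ {g = line} {λ u → f at d u [ 1≤d u ]} λ u → ≤-rescale {f2 + fromℚ (q u) * (f2 - f1)} {f at d u [ 1≤d u ]}
        {line u} {f at d u [ 1≤d u ]} 1ℚ
        (λ k → solve 4 (λ q x y z → con 1ℚ :* (z :- (y :+ q :* (y :- x)))
          := z :- (y :+ q :* (y :- x) :+ con 0ℚ :* con 0ℚ))
          refl (q u) (seq f1 k) (seq f2 k) (seq (f at d u [ 1≤d u ]) k))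
        (above-line (d u) (1≤d u)))
      where
      q : Fin n → ℚ
      q u = ι (d u) ℚ.- ι 2
      line : Fin n → ℝ
      -- The last summand is zero and only gives the shape expected by `sum-affine`.
      line u = f2 + fromℚ (q u) * (f2 - f1) + fromℚ 0ℚ * fromℕ 0
      open ≡-Reasoning
      eq : seq (sum line) ≗ seq (fromℕ n * f2)
      eq k = begin
        seq (sum line) k
          ≡⟨ sum-affine q (λ _ → 0ℚ) f2 (f2 - f1) (fromℕ 0) k ⟩
        ι n ℚ.* y ℚ.+ ∑ℚ q ℚ.* (y ℚ.- x) ℚ.+ R ℚ.* 0ℚ
          ≡⟨ cong (λ Q → ι n ℚ.* y ℚ.+ Q ℚ.* (y ℚ.- x) ℚ.+ R ℚ.* 0ℚ) ∑[d-2]≡0 ⟩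
        ι n ℚ.* y ℚ.+ 0ℚ ℚ.* (y ℚ.- x) ℚ.+ R ℚ.* 0ℚ
          ≡⟨ solve 4 (λ n x y r → n :* y :+ con 0ℚ :* (y :- x) :+ r :* con 0ℚ := n :* y)
               refl (ι n) x y R ⟩
        ι n ℚ.* y ∎
        where
        x = seq f1 k
        y = seq f2 k
        R = ∑ℚ {n} (λ _ → 0ℚ)

  -- Summing `below-line` gives n f(2) plus `p` times `excess`, where `p` is the number of ones
  -- among the degrees. With m+1 in place of `p` this is exactly the right-hand side, so the gap is
  -- (m+1-p) times `excess`.
  upper-bound : ∀ m (d : Fin (4 ℕ.+ m) → ℕ) (1≤d : ∀ u → 1 ≤ℕ d u) →
    (∀ u → d u ≤ℕ 3 ℕ.+ m) → ∑ℕ d ≡ (4 ℕ.+ m) ℕ.+ (4 ℕ.+ m) → ∑ℕ (leaf ∘ d) ≤ℕ 1 ℕ.+ m →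
    sum (λ u → f at d u [ 1≤d u ]) ≤
    f at 3 ℕ.+ m [ s≤s z≤n ] + fromℕ 2 * f2 + fromℕ (1 ℕ.+ m) * f1
  upper-bound m d 1≤d d≤ ∑d≡n+n leaves≤ =
    ≤-trans {Σf d 1≤d ∑d≡n+n} {sum line} {rhs}
      (sum-mono-≤ {g = λ u → f at d u [ 1≤d u ]} {line} λ u → below-line m (d u) (1≤d u) (d≤ u))
      (≤-rescale {fromℕ p * excess m} {fromℕ (1 ℕ.+ m) * excess m} {sum line} {rhs} 1ℚ eq
        (scaled-excess-mono m leaves≤))
    where
    n = 4 ℕ.+ m
    rhs = fN m + fromℕ 2 * f2 + fromℕ (1 ℕ.+ m) * f1
    q r : Fin n → ℚ
    q u = ι (d u) ℚ.- ι 2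
    r u = ι (leaf (d u))
    p : ℕ
    p = ∑ℕ (leaf ∘ d)
    line : Fin n → ℝ
    line u = f2 + fromℚ (q u) * slope m + fromℚ (r u) * excess m
    c = ι (suc m)
    v = 1/ι m
    open ≡-Reasoning
    eq : ∀ k → 1ℚ ℚ.* (c ℚ.* seq (excess m) k ℚ.- ι p ℚ.* seq (excess m) k)
      ≡ seq rhs k ℚ.- seq (sum line) k
    eq k = begin
      1ℚ ℚ.* (c ℚ.* E ℚ.- ι p ℚ.* E)
        ≡⟨ solve 6 (λ c v P x y z →
             let e = x :- y :+ v :* (z :- y) in
             con 1ℚ :* (c :* e :- P :* e)
             := (c :* v) :* (z :- y) :+ c :* (x :- y) :- P :* e) refl c v (ι p) x y z ⟩
      (c ℚ.* v) ℚ.* (z ℚ.- y) ℚ.+ c ℚ.* (x ℚ.- y) ℚ.- ι p ℚ.* E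
        -- Here m+1 cancels against the denominator of `slope`.
        ≡⟨ cong (λ u → u ℚ.* (z ℚ.- y) ℚ.+ c ℚ.* (x ℚ.- y) ℚ.- ι p ℚ.* E) (ι*1/ι m) ⟩
      1ℚ ℚ.* (z ℚ.- y) ℚ.+ c ℚ.* (x ℚ.- y) ℚ.- ι p ℚ.* E
        ≡⟨ solve 6 (λ c v P x y z →
             let e = x :- y :+ v :* (z :- y) in
             con 1ℚ :* (z :- y) :+ c :* (x :- y) :- P :* e
             := (z :+ con (ι 2) :* y :+ c :* x)
                :- ((con (ι 3) :+ c) :* y :+ con 0ℚ :* (v :* (z :- y)) :+ P :* e)) refl c v (ι p) x y z ⟩
      seq rhs k ℚ.- ((ι 3 ℚ.+ c) ℚ.* y ℚ.+ 0ℚ ℚ.* S ℚ.+ ι p ℚ.* E)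
        ≡⟨ cong (λ N → seq rhs k ℚ.- (N ℚ.* y ℚ.+ 0ℚ ℚ.* S ℚ.+ ι p ℚ.* E)) (ι-+ 3 (suc m)) ⟨
      seq rhs k ℚ.- (ι n ℚ.* y ℚ.+ 0ℚ ℚ.* S ℚ.+ ι p ℚ.* E)
        ≡⟨ cong₂ (λ Q R → seq rhs k ℚ.- (ι n ℚ.* y ℚ.+ Q ℚ.* S ℚ.+ R ℚ.* E))
             (∑[d-2]≡0 d 1≤d ∑d≡n+n) (∑ι (leaf ∘ d)) ⟨
      seq rhs k ℚ.- (ι n ℚ.* y ℚ.+ ∑ℚ q ℚ.* S ℚ.+ ∑ℚ r ℚ.* E)
        ≡⟨ cong (λ u → seq rhs k ℚ.- u) (sum-affine q r f2 (slope m) (excess m) k) ⟨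
      seq rhs k ℚ.- seq (sum line) k ∎
      where
      x = seq f1 k
      y = seq f2 k
      z = seq (fN m) k
      E = seq (excess m) k
      S = seq (slope m) k

-- Extremal graphs

sum-const : ∀ n a → seq (sum {n} λ _ → a) ≗ seq (fromℕ n * a)
sum-const zero    a k = solve 1 (λ a → con 0ℚ := con 0ℚ :* a) refl (seq a k)
sum-const (suc n) a k = begin
  seq a k ℚ.+ seq (sum {n} λ _ → a) k  ≡⟨ cong (seq a k ℚ.+_) (sum-const n a k) ⟩
  seq a k ℚ.+ ι n ℚ.* seq a k          ≡⟨ solve 2 (λ a n → a :+ n :* a := (con 1ℚ :+ n) :* a) refl (seq a k) (ι n) ⟩
  (1ℚ ℚ.+ ι n) ℚ.* seq a k             ≡⟨ cong (ℚ._* seq a k) (ι-suc n) ⟨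
  ι (suc n) ℚ.* seq a k                ∎
  where
  open ≡-Reasoning

∑-mono-≤ : ∀ {n} {g h : Fin n → ℕ} → (∀ i → g i ≤ℕ h i) → ∑ℕ g ≤ℕ ∑ℕ h
∑-mono-≤ {zero}  g≤h = z≤n
∑-mono-≤ {suc n} g≤h = ℕₚ.+-mono-≤ (g≤h zero) (∑-mono-≤ (g≤h ∘ suc))

-- With equal totals, a term above its bound would have to be offset by one below it.
∑-tight : ∀ {n} {g h : Fin n → ℕ} → (∀ i → g i ≤ℕ h i) → ∑ℕ h ≡ ∑ℕ g → ∀ i → h i ≡ g i
∑-tight {suc n} {g} {h} g≤h eq = go
  where
  open ℕₚ.≤-Reasoning
  head-≡ : h zero ≡ g zero
  head-≡ = ℕₚ.≤-antisym (ℕₚ.+-cancelʳ-≤ (∑ℕ (g ∘ suc)) (h zero) (g zero) (begin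
    h zero ℕ.+ ∑ℕ (g ∘ suc)  ≤⟨ ℕₚ.+-monoʳ-≤ (h zero) (∑-mono-≤ (g≤h ∘ suc)) ⟩
    ∑ℕ h                     ≡⟨ eq ⟩
    ∑ℕ g                     ∎)) (g≤h zero)
  go : ∀ i → h i ≡ g i
  go zero    = head-≡
  go (suc i) = ∑-tight (g≤h ∘ suc)
    (ℕₚ.+-cancelˡ-≡ (g zero) _ _ (trans (cong (ℕ._+ ∑ℕ (h ∘ suc)) (sym head-≡)) eq)) i

-- Criterion for uniqueness of the cycle.

module _ {A : Set} where

  consecutive⇒∈ : ∀ {xs} {a b : A} → Consecutive xs a b → a ∈ xs × b ∈ xs
  consecutive⇒∈ (here (refl ∷ refl ∷ _)) = here refl , there (here refl)
  consecutive⇒∈ (there c) = let a∈ , b∈ = consecutive⇒∈ c in there a∈ , there b∈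

  Linked-tabulate⁺ : ∀ {R : Rel A 0ℓ} {k z} (f : Fin (suc k) → A) →
    (∀ i → R (f (inject₁ i)) (f (suc i))) → R (f (lastFin k)) z →
    Linked R (List.tabulate f ++ [ z ])
  Linked-tabulate⁺ {k = zero}  f step last = last ∷ [-]
  Linked-tabulate⁺ {k = suc k} f step last =
    step zero ∷ Linked-tabulate⁺ (f ∘ suc) (step ∘ suc) last

module _ {n} (G : Graph n) where
  open Graph G using (Cycle; module Cycle; SameCycle)

  hasEdge⇒∈ : ∀ (D : Cycle) {u v} → Cycle.HasEdge D u v → u ∈ vertices G D × v ∈ vertices G D
  hasEdge⇒∈ D {u} {v} = [ both , Product.swap ∘ both ]′
    where
    -- The last entry of the closed list repeats the start.
    unroll : ∀ {w} → w ∈ vertices G D ++ [ Cycle.start D ] → w ∈ vertices G D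
    unroll w∈ with ∈ₚ.∈-++⁻ (vertices G D) w∈
    ... | inj₁ w∈D         = w∈D
    ... | inj₂ (here refl) = here refl
    both : ∀ {a b} → Consecutive (vertices G D ++ [ Cycle.start D ]) a b →
      a ∈ vertices G D × b ∈ vertices G D
    both c = let a∈ , b∈ = consecutive⇒∈ c in unroll a∈ , unroll b∈

  module _ {K : Rel (Fin n) 0ℓ} (hasEdge⇒K : ∀ D → Cycle.HasEdge D ⇒ K)
    (K-≤2 : ∀ {u a b c} → K u a → K u b → K u c → a ≢ b → c ≡ a ⊎ c ≡ b)
    (K-connected : ∀ {u a v b} → K u a → K v b → Star K u v) where

    -- At a vertex of `D` the two cycle edges exhaust the `K`-neighbours, so walking along `K` never
    -- leaves `D`. By connectedness `D` uses all of `K`.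
    K⇒hasEdge : ∀ D → K ⇒ Cycle.HasEdge D
    K⇒hasEdge D {u} {v} Kuv =
      let _ , _ , _ , e , _ = two-neighbours G D (here refl)
      in saturated (closed (here refl) (K-connected (hasEdge⇒K D e) Kuv)) Kuv
      where
      saturated : ∀ {u v} → u ∈ vertices G D → K u v → Cycle.HasEdge D u v
      saturated u∈ Kuv with two-neighbours G D u∈
      ... | a , b , a≢b , ua , ub with K-≤2 (hasEdge⇒K D ua) (hasEdge⇒K D ub) Kuv a≢b
      ...   | inj₁ refl = ua
      ...   | inj₂ refl = ub
      closed : ∀ {u v} → u ∈ vertices G D → Star K u v → v ∈ vertices G D
      closed u∈ ε        = u∈
      closed u∈ (k ◅ ks) = closed (proj₂ (hasEdge⇒∈ D (saturated u∈ k))) ks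

    -- Every cycle has edge relation exactly `K`, so any two agree.
    cycle⇒unicyclic : Cycle → Unicyclic G
    cycle⇒unicyclic C = C , λ D u v →
      mk⇔ (K⇒hasEdge C ∘ hasEdge⇒K D) (K⇒hasEdge D ∘ hasEdge⇒K C)

-- Equality in the lower bound.

module CycleGraph (k : ℕ) where

  n : ℕ
  n = 3 ℕ.+ k

  Next : Rel (Fin n) 0ℓ
  Next u v = toℕ v ≡ suc (toℕ u) ⊎ (toℕ u ≡ 2 ℕ.+ k × toℕ v ≡ 0)

  next? : Decidable Next
  next? u v = (toℕ v ℕₚ.≟ suc (toℕ u)) ⊎-dec ((toℕ u ℕₚ.≟ 2 ℕ.+ k) ×-dec (toℕ v ℕₚ.≟ 0))

  next-overflow : ∀ {u v : Fin n} {A : Set} → toℕ v ≡ suc (toℕ u) → toℕ u ≡ 2 ℕ.+ k → A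
  next-overflow {u} {v} v≡1+u u≡last =
    contradiction (toℕ<n v) (ℕₚ.≤⇒≯ (ℕₚ.≤-reflexive (sym (trans v≡1+u (cong suc u≡last)))))

  next-functional : ∀ {u a b} → Next u a → Next u b → a ≡ b
  next-functional (inj₁ p)       (inj₁ q)       = toℕ-injective (trans p (sym q))
  next-functional {u} {a} (inj₁ p)       (inj₂ (q , _)) = next-overflow {u} {a} p q
  next-functional {u} {_} {b} (inj₂ (q , _)) (inj₁ p)       = next-overflow {u} {b} p q
  next-functional (inj₂ (_ , p)) (inj₂ (_ , q)) = toℕ-injective (trans p (sym q))

  next-injective : ∀ {u a b} → Next a u → Next b u → a ≡ b
  next-injective (inj₁ p)       (inj₁ q)       = toℕ-injective (ℕₚ.suc-injective (trans (sym p) q))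
  next-injective (inj₁ p)       (inj₂ (_ , q)) = contradiction (trans (sym p) q) λ ()
  next-injective (inj₂ (_ , q)) (inj₁ p)       = contradiction (trans (sym p) q) λ ()
  next-injective (inj₂ (p , _)) (inj₂ (q , _)) = toℕ-injective (trans p (sym q))

  infix 4 _~_

  _~_ : Rel (Fin n) 0ℓ
  u ~ v = Next u v ⊎ Next v u

  ¬loop : ∀ {u} → ¬ Next u u
  ¬loop (inj₁ p)       = ℕₚ.1+n≢n (sym p)
  ¬loop (inj₂ (p , q)) = contradiction (trans (sym p) q) λ ()

  next-suc : ∀ (i : Fin (2 ℕ.+ k)) → Next (inject₁ i) (suc i)
  next-suc i = inj₁ (cong suc (sym (toℕ-inject₁ i)))

  zero⟶ : ∀ u → Star _~_ zero u
  zero⟶ = <-weakInduction (Star _~_ zero) ε λ i p → p ◅◅ (inj₁ (next-suc i) ◅ ε)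

  graph : Graph n
  graph = record
    { _~_       = _~_
    ; _~?_      = λ u v → next? u v ⊎-dec next? v u
    ; ~-sym     = swap
    ; ~-irrefl  = λ { refl → [ ¬loop , ¬loop ]′ }
    ; connected = λ u v → Star.reverse swap (zero⟶ u) ◅◅ zero⟶ v
    ; hasEdge   = zero , suc zero , inj₁ (inj₁ refl)
    }

  cycle : Graph.Cycle graph
  cycle = record
    { start    = zero
    ; rest     = List.tabulate suc
    ; length≥3 = s≤s (s≤s (s≤s z≤n))
    ; distinct = Uniqueₚ.tabulate⁺ id
    ; adjacent = Linked-tabulate⁺ id (λ i → inj₁ (next-suc i))
        (inj₁ (inj₂ (toℕ-fromℕ (2 ℕ.+ k) , refl)))
    }

  -- Each vertex has at most one successor and one predecessor, and a third neighbour falls in one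
  -- of these two directions.
  ~-≤2 : ∀ {u a b c} → u ~ a → u ~ b → u ~ c → a ≢ b → c ≡ a ⊎ c ≡ b
  ~-≤2 (inj₁ a) (inj₁ b) _        a≢b = contradiction (next-functional a b) a≢b
  ~-≤2 (inj₂ a) (inj₂ b) _        a≢b = contradiction (next-injective a b) a≢b
  ~-≤2 (inj₁ a) (inj₂ b) (inj₁ c) _   = inj₁ (next-functional c a)
  ~-≤2 (inj₁ a) (inj₂ b) (inj₂ c) _   = inj₂ (next-injective c b)
  ~-≤2 (inj₂ a) (inj₁ b) (inj₁ c) _   = inj₂ (next-functional c b)
  ~-≤2 (inj₂ a) (inj₁ b) (inj₂ c) _   = inj₁ (next-injective c a)

  unicyclic : Unicyclic graph
  unicyclic = cycle⇒unicyclic graph (hasEdge⇒~ graph) ~-≤2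
    (λ {u} {_} {v} _ _ → Graph.connected graph u v) cycle

  -- Every vertex lies on the cycle and so has degree at least 2; the total 2n leaves no room for
  -- more.
  degree≡2 : ∀ u → degree graph u ≡ 2
  degree≡2 = ∑-tight {g = λ _ → 2} {degree graph}
    (λ u → cycle-degree graph cycle (∈ₚ.∈-tabulate⁺ {f = id} u))
    (trans (unicyclic⇒∑degree graph unicyclic)
      (sym (trans (∑-distrib-+ {n} (λ _ → 1) (λ _ → 1)) (cong₂ ℕ._+_ (∑-1 n) (∑-1 n)))))

  I≈lower : ∀ f → I f graph ≈ fromℕ n * f at 2 [ s≤s z≤n ]
  I≈lower f = ≈-trans {I f graph} {sum {n} λ _ → f2} {fromℕ n * f2}
    (sum-cong {g = λ u → f at degree graph u [ 1≤degree graph u ]} {λ _ → f2}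
      λ u → at-cong f (1≤degree graph u) (s≤s z≤n) (degree≡2 u))
    (≗⇒≈ {sum {n} λ _ → f2} {fromℕ n * f2} (sum-const n f2))
    where
    f2 = f at 2 [ s≤s z≤n ]

-- Equality in the upper bound.

module TriangleWithLeaves (k : ℕ) where

  n : ℕ
  n = 3 ℕ.+ k

  -- Vertices 0, 1, 2 form the triangle, and all others hang from 0.
  adj : Fin n → Fin n → Bool
  adj zero             zero             = false
  adj zero             (suc _)          = true
  adj (suc _)          zero             = true
  adj (suc zero)       (suc (suc zero)) = true
  adj (suc (suc zero)) (suc zero)       = true
  adj (suc _)          (suc _)          = false

  infix 4 _~_

  _~_ : Rel (Fin n) 0ℓ
  u ~ v = T (adj u v)

  ~-sym : Symmetric _~_
  ~-sym {zero}           {suc _}          _ = tt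
  ~-sym {suc zero}       {zero}           _ = tt
  ~-sym {suc (suc _)}    {zero}           _ = tt
  ~-sym {suc zero}       {suc (suc zero)} _ = tt
  ~-sym {suc (suc zero)} {suc zero}       _ = tt

  ~-irrefl : ∀ {u} → ¬ u ~ u
  ~-irrefl {suc (suc zero)}    ()
  ~-irrefl {suc (suc (suc _))} ()

  ⟶zero : ∀ u → Star _~_ u zero
  ⟶zero zero    = ε
  ⟶zero (suc _) = tt ◅ ε

  graph : Graph n
  graph = record
    { _~_       = _~_
    ; _~?_      = λ u v → T? (adj u v)
    ; ~-sym     = λ {u} → ~-sym {u}
    ; ~-irrefl  = λ { {u} refl → ~-irrefl {u} }
    ; connected = λ u v → ⟶zero u ◅◅ Star.reverse (λ {u} → ~-sym {u}) (⟶zero v)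
    ; hasEdge   = zero , suc zero , tt
    }

  -- Corners indexed by `Fin 3` make `pigeonhole₃` a finite check, whatever the value of `k`.
  corner : Fin 3 → Fin n
  corner zero             = zero
  corner (suc zero)       = suc zero
  corner (suc (suc zero)) = suc (suc zero)

  -- The uniqueness criterion is applied to this relation and not to adjacency, since pendant edges
  -- lie on no cycle.
  Side : Rel (Fin n) 0ℓ
  Side u v = ∃₂ λ i j → u ≡ corner i × v ≡ corner j × i ≢ j

  corner-injective : ∀ {i j} → corner i ≡ corner j → i ≡ j
  corner-injective {zero}           {zero}           refl = refl
  corner-injective {zero}           {suc zero}       ()
  corner-injective {zero}           {suc (suc zero)} ()
  corner-injective {suc zero}       {suc zero}       refl = refl
  corner-injective {suc zero}       {suc (suc zero)} ()
  corner-injective {suc (suc zero)} {suc (suc zero)} refl = refl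

  pigeonhole₃ : ∀ (i a b c : Fin 3) → i ≢ a → i ≢ b → i ≢ c → a ≢ b → c ≡ a ⊎ c ≡ b
  pigeonhole₃ = from-yes (all? {3} λ i → all? {3} λ a → all? {3} λ b → all? {3} λ c →
    ¬? (i ≟ a) →-dec ¬? (i ≟ b) →-dec ¬? (i ≟ c) →-dec ¬? (a ≟ b) →-dec ((c ≟ a) ⊎-dec (c ≟ b)))

  side-≤2 : ∀ {u a b c} → Side u a → Side u b → Side u c → a ≢ b → c ≡ a ⊎ c ≡ b
  side-≤2 (i , a , refl , refl , i≢a) (i′ , b , i≡i′ , refl , i≢b) (i″ , c , i≡i″ , refl , i≢c) a≢b
    with corner-injective i≡i′ | corner-injective i≡i″
  ... | refl | refl with pigeonhole₃ i a b c i≢a i≢b i≢c (a≢b ∘ cong corner)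
  ...   | inj₁ c≡a = inj₁ (cong corner c≡a)
  ...   | inj₂ c≡b = inj₂ (cong corner c≡b)

  side-connected : ∀ {u a v b} → Side u a → Side v b → Star Side u v
  side-connected (i , _ , refl , _) (j , _ , refl , _) with i ≟ j
  ... | yes refl = ε
  ... | no i≢j   = (i , j , refl , refl , i≢j) ◅ ε

  -- A pendant vertex has 0 as its only neighbour, whereas a cycle vertex has two.
  on-cycle⇒corner : ∀ D {u} → u ∈ vertices graph D → ∃[ i ] u ≡ corner i
  on-cycle⇒corner D {zero}                _  = zero , refl
  on-cycle⇒corner D {suc zero}            _  = suc zero , refl
  on-cycle⇒corner D {suc (suc zero)}      _  = suc (suc zero) , refl
  on-cycle⇒corner D {u@(suc (suc (suc x)))} u∈ =
    let a , b , a≢b , ua , ub = two-neighbours graph D u∈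
    in contradiction (trans (pendant a (hasEdge⇒~ graph D ua)) (sym (pendant b (hasEdge⇒~ graph D ub)))) a≢b
    where
    pendant : ∀ v → u ~ v → v ≡ zero
    pendant zero _ = refl

  hasEdge⇒side : ∀ (D : Graph.Cycle graph) → Graph.Cycle.HasEdge D ⇒ Side
  hasEdge⇒side D {u} {v} e =
    let u∈ , v∈ = hasEdge⇒∈ graph D e
        i , u≡ = on-cycle⇒corner D u∈
        j , v≡ = on-cycle⇒corner D v∈
    in i , j , u≡ , v≡ , λ i≡j → ~-irrefl {u}
         (subst (u ~_) (trans v≡ (trans (cong corner (sym i≡j)) (sym u≡))) (hasEdge⇒~ graph D e))

  cycle : Graph.Cycle graph
  cycle = record
    { start    = zero
    ; rest     = suc zero ∷ suc (suc zero) ∷ []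
    ; length≥3 = s≤s (s≤s (s≤s z≤n))
    ; distinct = ((λ ()) ∷ (λ ()) ∷ []) ∷ ((λ ()) ∷ []) ∷ [] ∷ []
    ; adjacent = tt ∷ tt ∷ tt ∷ [-]
    }

  unicyclic : Unicyclic graph
  unicyclic = cycle⇒unicyclic graph hasEdge⇒side side-≤2 side-connected cycle

  -- Past the first three columns every row of `adj` is constant, so this evaluates all degrees.
  ∣const∣ : ∀ b l → ∣ tabulate {n = l} (λ _ → b) ∣ ≡ (if b then l else 0)
  ∣const∣ true  zero    = refl
  ∣const∣ true  (suc l) = cong suc (∣const∣ true l)
  ∣const∣ false zero    = refl
  ∣const∣ false (suc l) = ∣const∣ false l

  I≈upper : ∀ f → I f graph ≈
    f at 2 ℕ.+ k [ s≤s z≤n ] + fromℕ 2 * f at 2 [ s≤s z≤n ] + fromℕ k * f at 1 [ s≤s z≤n ]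
  I≈upper f = ≈-trans {I f graph} {fN + (f2 + (f2 + sum {k} λ _ → f1))} {rhs}
    (+-cong {value zero} {fN} {value (suc zero) + (value (suc (suc zero)) + sum rest)} {f2 + (f2 + sum {k} λ _ → f1)}
      (value-≈ zero (s≤s z≤n) (cong (2 ℕ.+_) (∣const∣ true k)))
      (+-cong {value (suc zero)} {f2} {value (suc (suc zero)) + sum rest} {f2 + sum {k} λ _ → f1}
        (value-≈ (suc zero) (s≤s z≤n) (cong (2 ℕ.+_) (∣const∣ false k)))
        (+-cong {value (suc (suc zero))} {f2} {sum rest} {sum {k} λ _ → f1}
          (value-≈ (suc (suc zero)) (s≤s z≤n) (cong (2 ℕ.+_) (∣const∣ false k)))
          (sum-cong {g = rest} {λ _ → f1} λ i →
            value-≈ (suc (suc (suc i))) (s≤s z≤n) (cong suc (∣const∣ false k))))))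
    (≗⇒≈ {fN + (f2 + (f2 + sum {k} λ _ → f1))} {rhs} λ j →
      trans (cong (λ s → seq fN j ℚ.+ (seq f2 j ℚ.+ (seq f2 j ℚ.+ s))) (sum-const k f1 j))
        (solve 3 (λ N y s → N :+ (y :+ (y :+ s)) := N :+ con (ι 2) :* y :+ s) refl
          (seq fN j) (seq f2 j) (ι k ℚ.* seq f1 j)))
    where
    fN = f at 2 ℕ.+ k [ s≤s z≤n ]
    f2 = f at 2 [ s≤s z≤n ]
    f1 = f at 1 [ s≤s z≤n ]
    rhs = fN + fromℕ 2 * f2 + fromℕ k * f1
    value : Fin n → ℝ
    value u = f at degree graph u [ 1≤degree graph u ]
    rest : Fin k → ℝ
    rest i = value (suc (suc (suc i)))
    value-≈ : ∀ u {l} (1≤l : 1 ≤ℕ l) → degree graph u ≡ l → value u ≈ f at l [ 1≤l ]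
    value-≈ u 1≤l = at-cong f (1≤degree graph u) 1≤l

theorem3p4 : (n : ℕ) (4≤n : 4 ≤ℕ n) (f : [1,∞[ ⟶ₛ ℝ-setoid) → Convex f →
    let f1    = f at 1 [ s≤s z≤n ]
        f2    = f at 2 [ s≤s z≤n ]
        fn-1  = f at (n ∸ 1) [ 4≤n⇒1≤n∸1 4≤n ]
        lower = fromℕ n * f2
        upper = fn-1 + fromℕ 2 * f2 + fromℕ (n ∸ 3) * f1
    in ((G : Graph n) → Unicyclic G → lower ≤ I f G × I f G ≤ upper)
       × (Σ[ G ∈ Graph n ] (Unicyclic G × I f G ≈ lower))
       × (Σ[ G ∈ Graph n ] (Unicyclic G × I f G ≈ upper))
theorem3p4 _ (s≤s (s≤s (s≤s (s≤s {n = m} z≤n)))) f convex =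
  (λ G unicyclic →
    let ∑degree = unicyclic⇒∑degree G unicyclic in
    lower-bound (degree G) (1≤degree G) ∑degree
    , upper-bound m (degree G) (1≤degree G) (λ u → ℕₚ.≤-pred (degree<n G u)) ∑degree
        -- Here n = 3 + (m+1), so cancelling 3 bounds the number of leaves by n-3.
        (ℕₚ.+-cancelʳ-≤ 3 _ _ (subst (∑ℕ (leaf ∘ degree G) ℕ.+ 3 ≤ℕ_) (ℕₚ.+-comm 3 (suc m))
          (leaves+3≤n G (proj₁ unicyclic)))))
  -- Both families have 3 + k vertices, which makes k = m+1.
  , (CycleGraph.graph (suc m) , CycleGraph.unicyclic (suc m) , CycleGraph.I≈lower (suc m) f)
  , (TriangleWithLeaves.graph (suc m) , TriangleWithLeaves.unicyclic (suc m) , TriangleWithLeaves.I≈upper (suc m) f)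
  where open ConvexBounds f convex
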